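{- Let $s,t\ge1$, $n>s+t$ and $N=n+2s+t$. Let $\beta_{1,3}(s,t,n)$ be the number of continuous multiline queues of type $(s,t,n-s-t)$ with the largest entry $N$ in the last row and exactly one wrapping from the second row to the third row, whose projected word $\omega$ has $\omega_1=1$ and $\omega_2=3$. Then $$\beta_{1,3}(s,t,n)=\binom{N-1}{s-2}f_{(n-1,s+t)}.$$
   Context: A continuous multiline queue of type $(s,t,n-s-t)$ is a three-row array whose rows are strictly increasing sequences $a_1<\cdots<a_s$, $b_1<\cdots<b_{s+t}$, $c_1<\cdots<c_n$, whose $N$ entries are exactly $1,\ldots,N$, each once. Bully path procedure: initially all entries are available. First, each entry of row 1 starts a bully path; then each still-available entry of row 2 starts a bully path. An entry $x$ on a path bullies the smallest available entry of the next row larger than $x$, or, if there is none, the smallest available entry of the next row (a wrapping from that row to the next); bullied entries become unavailable and the path continues to row 3. Endpoints of paths starting in row 1 get label 1, those starting in row 2 get label 2, remaining entries of row 3 get label 3. The projected word is $\omega=(\omega_1,\ldots,\omega_n)$, $\omega_k$ the label of $c_k$. $f_{(a,b)}$ is the number of standard Young tableaux of shape $(a,b)$, equal to $\frac{a-b+1}{a+1}\binom{a+b}{a}$ for $a\ge b\ge0$. Binomial coefficients $\binom{x}{k}$ with $k<0$ are $0$. -}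

module Defs where

open import Data.Nat using (ℕ; zero; suc; _+_; _*_; _∸_; _<ᵇ_; _≡ᵇ_)
open import Data.Nat.Combinatorics using (_C_)
open import Data.Bool using (Bool; true; false; if_then_else_; _∧_; not)
open import Data.List using (List; []; _∷_; map; concatMap; filterᵇ; length; last)
open import Data.Maybe using (Maybe; just; nothing)
open import Data.Product using (_×_; _,_)

allWords : {A : Set} → List A → ℕ → List (List A)
allWords alph zero    = [] ∷ []
allWords alph (suc N) = concatMap (λ w → map (λ a → a ∷ w) alph) (allWords alph N)

positionsFrom : {A : Set} → (A → Bool) → ℕ → List A → List ℕ
positionsFrom p k []       = []
positionsFrom p k (a ∷ w) = if p a then k ∷ positionsFrom p (suc k) w
                                    else positionsFrom p (suc k) w

positions : {A : Set} → (A → Bool) → List A → List ℕ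
positions p w = positionsFrom p 1 w

nth : ℕ → List ℕ → Maybe ℕ
nth k       []       = nothing
nth zero    (x ∷ xs) = just x
nth (suc k) (x ∷ xs) = nth k xs

-- Standard Young tableaux of two-row shape (a,b).
-- A filling of the shape with 1..a+b with increasing rows is determined by
-- which row each entry i goes to (the row then lists its entries in
-- increasing order); it is standard iff additionally the columns increase:
-- for each j < b, (j-th entry of row 1) < (j-th entry of row 2).

data TRow : Set where top bot : TRow

isTop isBot : TRow → Bool
isTop top = true
isTop bot = false
isBot top = false
isBot bot = true

columnsIncrease : List ℕ → List ℕ → Bool
columnsIncrease (x ∷ xs) (y ∷ ys) = (x <ᵇ y) ∧ columnsIncrease xs ys
columnsIncrease []       (y ∷ ys) = false
columnsIncrease _        []       = true

isSYT : ℕ → ℕ → List TRow → Bool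
isSYT a b w = (length (positions isTop w) ≡ᵇ a)
            ∧ (length (positions isBot w) ≡ᵇ b)
            ∧ columnsIncrease (positions isTop w) (positions isBot w)

f : ℕ → ℕ → ℕ
f a b = length (filterᵇ (isSYT a b) (allWords (top ∷ bot ∷ []) (a + b)))

-- binomial coefficient  binom x (s-2), with the convention that it is 0 when s-2 < 0
binomMinus2 : ℕ → ℕ → ℕ
binomMinus2 x zero          = 0
binomMinus2 x (suc zero)    = 0
binomMinus2 x (suc (suc k)) = x C k

-- Continuous multiline queues on {1..N}: each entry is placed in one of
-- three rows; the rows are the increasing lists of their entries.
-- A word w of length N over {r1,r2,r3} (letter i = row of entry i)
-- is in bijection with the triples of strictly increasing rows partitioning
-- {1..N}.

data Row : Set where r1 r2 r3 : Row

is1 is2 is3 : Row → Bool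
is1 r1 = true
is1 _  = false
is2 r2 = true
is2 _  = false
is3 r3 = true
is3 _  = false

row1 row2 row3 : List Row → List ℕ
row1 w = positions is1 w
row2 w = positions is2 w
row3 w = positions is3 w

firstGt : ℕ → List ℕ → Maybe ℕ
firstGt x []       = nothing
firstGt x (y ∷ ys) = if x <ᵇ y then just y else firstGt x ys

-- the entry bullied by x among the available ones, with a flag telling
-- whether this was a wrapping
pick : ℕ → List ℕ → Maybe (ℕ × Bool)
pick x []       = nothing
pick x (y ∷ ys) with firstGt x (y ∷ ys)
... | just z  = just (z , false)
... | nothing = just (y , true)

remove : ℕ → List ℕ → List ℕ
remove y = filterᵇ (λ z → not (z ≡ᵇ y))

-- state: available entries of row 2, of row 3, labels assigned to
-- row-3 entries, number of wrappings from row 2 to row 3 so far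
record St : Set where
  constructor st
  field
    av2  : List ℕ
    av3  : List ℕ
    labs : List (ℕ × ℕ)
    w23  : ℕ
open St public

step23 : ℕ → ℕ → St → Maybe St
step23 ℓ y (st a2 a3 lb w) with pick y a3
... | nothing      = nothing
... | just (z , b) = just (st a2 (remove z a3) ((z , ℓ) ∷ lb) (if b then suc w else w))

path1 : ℕ → St → Maybe St
path1 x (st a2 a3 lb w) with pick x a2
... | nothing      = nothing
... | just (y , _) = step23 1 y (st (remove y a2) a3 lb w)

runAll : (ℕ → St → Maybe St) → List ℕ → St → Maybe St
runAll g []       σ = just σ
runAll g (x ∷ xs) σ with g x σ
... | nothing = nothing
... | just σ' = runAll g xs σ'

bully : List Row → Maybe St
bully w with runAll path1 (row1 w) (st (row2 w) (row3 w) [] 0)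
... | nothing = nothing
... | just σ  = runAll (step23 2) (av2 σ) σ

labelIn : List (ℕ × ℕ) → ℕ → ℕ
labelIn []             c = 3
labelIn ((z , ℓ) ∷ lb) c = if z ≡ᵇ c then ℓ else labelIn lb c

projWord : St → List ℕ → List ℕ
projWord σ cs = map (labelIn (labs σ)) cs

lastIs3 : List Row → Bool
lastIs3 w with last w
... | just r3 = true
... | _       = false

startsWith13 : List ℕ → Bool
startsWith13 (a ∷ b ∷ _) = (a ≡ᵇ 1) ∧ (b ≡ᵇ 3)
startsWith13 _           = false

isType : ℕ → ℕ → ℕ → List Row → Bool
isType s t n w = (length (row1 w) ≡ᵇ s) ∧ (length (row2 w) ≡ᵇ s + t)
               ∧ (length (row3 w) ≡ᵇ n)

bullyCond : List Row → Bool
bullyCond w with bully w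
... | nothing = false
... | just σ  = (w23 σ ≡ᵇ 1) ∧ startsWith13 (projWord σ (row3 w))

good : ℕ → ℕ → ℕ → List Row → Bool
good s t n w = isType s t n w ∧ lastIs3 w ∧ bullyCond w

β13 : ℕ → ℕ → ℕ → ℕ
β13 s t n = length (filterᵇ (good s t n) (allWords (r1 ∷ r2 ∷ r3 ∷ []) (n + 2 * s + t)))

{-# OPTIONS --safe #-}
module Submission where

-- Read the queue as a word in 1, 2, 3.  If the only wrapping leaves the second 3 free, it ends on the first 3
-- and no 2 precedes the second 3.  Since matching 2s with 3s is insensitive to the order in which
-- the 2s are processed, the condition on the queue becomes: the word is 1^i 3 1^j 3 w, ends in 3, exactly one 2 of w has
-- no partner among the 3s to its right, and all 2s of the shortest suffix Q of w having one more 2 than 3s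
-- are matched by 1s to their left (t ≥ 1 turns the cyclic matching of 1s with 2s into a linear one).
--
-- Such words w with a 1s, b 2s and c 3s are counted by C(a+b+c−1, a−2) f(c+1, b) if i + j + a < b.
-- Behind this is a bijection: delete the last 3, turn the two unpaired 2s into 3s and then the two leftmost
-- unmatched 1s into 2s (the crystal operators f₂² and f₁²); the image consists of the words with a − 2 1s
-- whose 2/3-subword read backwards is a ballot word.  Tracking k pending 1s through this bijection gives
-- an identity for all a, b, c, k whose correction terms satisfy the same first-letter recursion,
-- so that it can be verified by induction, and these terms vanish for k + a < b.
-- The letters 1 and 3 in front of w contribute two Pascal steps.

open import Defs
open import Data.Nat using (ℕ; zero; suc; pred; _+_; _*_; _∸_; _≤_; _<_; z≤n; s≤s; _≡ᵇ_; _<ᵇ_)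
open import Data.Nat.Properties
open import Data.Nat.Combinatorics using (_C_; nCn≡1; nCk+nC[k+1]≡[n+1]C[k+1])
open import Data.Nat.Tactic.RingSolver using (solve-∀)
open import Data.Bool using (Bool; T; true; false; if_then_else_; _∧_)
open import Data.Bool.Properties using (∧-zeroʳ; ∧-identityʳ; ∧-assoc)
open import Data.List using (List; []; _∷_; map; concatMap; filterᵇ; length; _++_; foldl; foldr; drop)
open import Data.List.Properties using (length-++; ++-assoc; foldl-++; reverse-foldl)
open import Data.List.Membership.Propositional using (_∈_)
open import Data.List.Membership.Propositional.Properties using (∈-++⁻)
open import Data.List.Relation.Unary.Any using (here; there)
open import Data.List.Relation.Unary.All as All using (All; []; _∷_)
open import Data.List.Relation.Unary.All.Properties using (++⁺)
open import Data.List.Relation.Unary.AllPairs as AllPairs using (AllPairs; []; _∷_)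
import Data.List.Relation.Unary.AllPairs.Properties as AllPairsₚ
open import Data.List.Relation.Ternary.Interleaving.Propositional using (Interleaving; consˡ; consʳ; toPermutation; [])
open import Data.List.Relation.Binary.Permutation.Propositional as ↭ using (_↭_; refl; prep; swap; ↭-sym; ↭-trans; ↭-refl)
open import Data.List.Relation.Binary.Permutation.Propositional.Properties using (↭-reverse; All-resp-↭; ∈-resp-↭; ++⁺ʳ)
open import Data.Maybe using (Maybe; just; nothing; _>>=_)
open import Data.Product using (_×_; _,_; proj₁; proj₂; ∃; ∃₂)
open import Data.Sum using (_⊎_; inj₁; inj₂)
open import Data.Empty using (⊥-elim)
open import Relation.Nullary using (yes; no)
open import Relation.Binary.PropositionalEquality using (_≡_; _≢_; refl; sym; trans; cong; cong₂; subst; module ≡-Reasoning)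

-- Counting functions given by first-letter recursions

prec : ℕ → (ℕ → ℕ) → ℕ
prec zero    g = 0
prec (suc n) g = g n

-- The contribution of the empty word, in the shifted arguments of `chamber`.
δ₁₁ : ℕ → ℕ → ℕ
δ₁₁ a zero          = 0
δ₁₁ a (suc zero)    = if a ≡ᵇ 1 then 1 else 0
δ₁₁ a (suc (suc b)) = 0

-- chamber (1 + k) (2 + a) (2 + b) d counts the words with a 1s, b 2s and b + d 3s that have
-- k + #1 ≥ #2 in every prefix and #3 ≥ #2 in every suffix, by their first letter.  The shifts let
-- the arguments k − 1, a − 2 and b − 2 of the identities below be written without subtraction.
chamber : ℕ → ℕ → ℕ → ℕ → ℕ
chamber zero    a       b       d       = 0
chamber (suc κ) zero    b       d       = 0
chamber (suc κ) (suc a) zero    d       = 0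
chamber (suc κ) (suc a) (suc b) zero    =
  (chamber (suc (suc κ)) a (suc b) zero + chamber κ (suc a) b 1) + δ₁₁ a b
chamber (suc κ) (suc a) (suc b) (suc d) =
  (chamber (suc (suc κ)) a (suc b) (suc d) + chamber κ (suc a) b (suc (suc d))) + chamber (suc κ) (suc a) (suc b) d

-- Numbers of words accepted by tailAccepts k (with a 1s, b 2s, b + d 3s) and by suffixAccepts k
-- (with a 1s, b 2s, b + e − 1 3s).  The subscript is the first letter of the word, except that
-- wordCount₃ with e = 0 counts the words whose first letter is the 2 starting the suffix Q.
tailCount : ℕ → ℕ → ℕ → ℕ → ℕ
tailCount₁ tailCount₂ tailCount₃ : ℕ → ℕ → ℕ → ℕ → ℕ
tailCount k a b d = (tailCount₁ k a b d + tailCount₂ k a b d) + tailCount₃ k a b d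
tailCount₁ k zero    b d = 0
tailCount₁ k (suc a) b d = tailCount (suc k) a b d
tailCount₂ k       a zero    d = 0
tailCount₂ zero    a (suc b) d = 0
tailCount₂ (suc k) a (suc b) d = tailCount k a b (suc d)
tailCount₃ k a       b       zero          = 0
tailCount₃ k zero    zero    (suc zero)    = 1
tailCount₃ k a       b       (suc d)       = tailCount k a b d

wordCount : ℕ → ℕ → ℕ → ℕ → ℕ
wordCount₁ wordCount₃ : ℕ → ℕ → ℕ → ℕ → ℕ
wordCount k a zero    e = 0
wordCount k a (suc b) e = (wordCount₁ k a (suc b) e + wordCount (pred k) a b (suc e)) + wordCount₃ k a (suc b) e
wordCount₁ k zero    b e = 0
wordCount₁ k (suc a) b e = wordCount (suc k) a b e
wordCount₃ k       a zero    e       = 0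
wordCount₃ zero    a (suc b) zero    = 0
wordCount₃ (suc k) a (suc b) zero    = tailCount k a b zero
wordCount₃ k       a (suc b) (suc e) = wordCount k a (suc b) e

-- Boundary values and vanishing of the chamber numbers

chamber-a0 : ∀ κ b d → chamber κ 0 b d ≡ 0
chamber-a0 zero    b d = refl
chamber-a0 (suc κ) b d = refl

chamber-b0 : ∀ κ a d → chamber κ a 0 d ≡ 0
chamber-b0 zero    a       d = refl
chamber-b0 (suc κ) zero    d = refl
chamber-b0 (suc κ) (suc a) d = refl

δ₁₁-0 : ∀ b → δ₁₁ 0 b ≡ 0
δ₁₁-0 zero          = refl
δ₁₁-0 (suc zero)    = refl
δ₁₁-0 (suc (suc b)) = refl

chamber-a1 : ∀ κ b d → chamber κ 1 b d ≡ 0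
chamber-a1 zero    b       d       = refl
chamber-a1 (suc κ) zero    d       = refl
chamber-a1 (suc κ) (suc b) zero    = cong₂ _+_ (chamber-a1 κ b 1) (δ₁₁-0 b)
chamber-a1 (suc κ) (suc b) (suc d) = cong₂ _+_ (chamber-a1 κ b (suc (suc d))) (chamber-a1 (suc κ) (suc b) d)

chamber-b1 : ∀ κ a d → chamber κ a 1 d ≡ 0
chamber-b1 zero    a       d       = refl
chamber-b1 (suc κ) zero    d       = refl
chamber-b1 (suc κ) (suc a) zero    rewrite chamber-b1 (suc (suc κ)) a 0 | chamber-b0 κ (suc a) 1 = refl
chamber-b1 (suc κ) (suc a) (suc d)
  rewrite chamber-b1 (suc (suc κ)) a (suc d) | chamber-b0 κ (suc a) (suc (suc d)) | chamber-b1 (suc κ) (suc a) d = refl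

-- Away from the empty word the cases of the definition merge into one recursion, with `prec`
-- supplying the zeros at the boundary.
chamber-step : ∀ κ a b d → δ₁₁ (pred a) b ≡ 0 →
  chamber (suc κ) a (suc b) d ≡
    (prec a (λ a′ → chamber (suc (suc κ)) a′ (suc b) d) + chamber κ a b (suc d)) + prec d (chamber (suc κ) a (suc b))
chamber-step κ zero    b zero    _ rewrite chamber-a0 κ b 1 = refl
chamber-step κ zero    b (suc d) _ rewrite chamber-a0 κ b (suc (suc d)) = refl
chamber-step κ (suc a) b zero    p rewrite p = refl
chamber-step κ (suc a) b (suc d) _ = refl

-- With the shifts undone, the bound says k + #1 < #2 for the whole word, which then violates the
-- prefix condition.
chamber-vanish : ∀ κ a b d → κ + a ≤ b → chamber κ a b d ≡ 0
chamber-vanish zero    a       b       d       _ = refl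
chamber-vanish (suc κ) zero    b       d       _ = refl
chamber-vanish (suc κ) (suc a) (suc b) zero    (s≤s p) =
  cong₂ _+_ (cong₂ _+_ (chamber-vanish (suc (suc κ)) a (suc b) 0 (s≤s (subst (_≤ b) (+-suc κ a) p)))
                       (chamber-vanish κ (suc a) b 1 p))
            (δ-vanish a b p)
  where
  δ-vanish : ∀ a b → κ + suc a ≤ b → δ₁₁ a b ≡ 0
  δ-vanish a       zero          q = refl
  δ-vanish zero    (suc zero)    q = refl
  δ-vanish (suc a) (suc zero)    q with subst (_≤ 1) (+-suc κ (suc a)) q
  ... | s≤s r with subst (_≤ 0) (+-suc κ a) r
  ... | ()
  δ-vanish a       (suc (suc b)) q = refl
chamber-vanish (suc κ) (suc a) (suc b) (suc d) (s≤s p) =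
  cong₂ _+_ (cong₂ _+_ (chamber-vanish (suc (suc κ)) a (suc b) (suc d) (s≤s (subst (_≤ b) (+-suc κ a) p)))
                       (chamber-vanish κ (suc a) b (suc (suc d)) p))
            (chamber-vanish (suc κ) (suc a) (suc b) d (s≤s p))

δ₀ : ℕ → ℕ → ℕ → ℕ
δ₀ zero    a b = δ₁₁ a (suc b)
δ₀ (suc d) a b = 0

chamber-step₂ : ∀ k a b d →
  chamber (suc k) (suc a) (2 + b) d ≡
    (chamber (2 + k) a (2 + b) d + δ₀ d a b + chamber k (suc a) (1 + b) (suc d)) + prec d (chamber (suc k) (suc a) (2 + b))
chamber-step₂ k a b zero    = lem (chamber (2 + k) a (2 + b) 0) (chamber k (suc a) (1 + b) 1) (δ₁₁ a (suc b))
  where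
  lem : ∀ x y z → x + y + z ≡ x + z + y + 0
  lem = solve-∀
chamber-step₂ k a b (suc d) =
  cong (λ x → x + chamber k (suc a) (1 + b) (2 + d) + chamber (suc k) (suc a) (2 + b) d) (sym (+-identityʳ _))

-- The identity for tails

three-sums : ∀ x₁ x₂ x₃ y₁ y₂ y₃ {z₁ z₂ z₃ : ℕ} →
  x₁ + y₁ ≡ z₁ → x₂ + y₂ ≡ z₂ → x₃ + y₃ ≡ z₃ →
  ((x₁ + x₂) + x₃) + ((y₁ + y₂) + y₃) ≡ (z₁ + z₂) + z₃
three-sums x₁ x₂ x₃ y₁ y₂ y₃ refl refl refl = lem x₁ x₂ x₃ y₁ y₂ y₃
  where
  lem : ∀ x₁ x₂ x₃ y₁ y₂ y₃ →
    ((x₁ + x₂) + x₃) + ((y₁ + y₂) + y₃) ≡ ((x₁ + y₁) + (x₂ + y₂)) + (x₃ + y₃)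
  lem = solve-∀

-- The right side counts, by first letter, the nonempty words with the prefix and suffix conditions
-- of `chamber`. Such a word cannot end in 2. Those ending in 3 are the tails; those ending in 1
-- lose that 1 and give the `chamber` term on the left. The word 1 thereby becomes the empty word,
-- which is the source of `δ₀` in the part for first letter 1.
tailCount-chamber : ∀ k a b d →
  tailCount k a b d + chamber (suc k) (1 + a) (2 + b) d ≡
    (chamber (2 + k) (1 + a) (2 + b) d + chamber k (2 + a) (1 + b) (suc d)) + prec d (chamber (suc k) (2 + a) (2 + b))
tailCount-chamber₁ : ∀ k a b d →
  tailCount₁ k a b d + (chamber (2 + k) a (2 + b) d + δ₀ d a b) ≡ chamber (2 + k) (1 + a) (2 + b) d
tailCount-chamber₂ : ∀ k a b d →
  tailCount₂ k a b d + chamber k (1 + a) (1 + b) (suc d) ≡ chamber k (2 + a) (1 + b) (suc d)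
tailCount-chamber₃ : ∀ k a b d →
  tailCount₃ k a b d + prec d (chamber (suc k) (1 + a) (2 + b)) ≡ prec d (chamber (suc k) (2 + a) (2 + b))
tailCount-chamber k a b d rewrite chamber-step₂ k a b d =
  three-sums (tailCount₁ k a b d) (tailCount₂ k a b d) (tailCount₃ k a b d) _ _ _
    (tailCount-chamber₁ k a b d) (tailCount-chamber₂ k a b d) (tailCount-chamber₃ k a b d)
tailCount-chamber₁ k zero    b zero    = trans (δ₁₁-0 (suc b)) (sym (chamber-a1 (2 + k) (2 + b) 0))
tailCount-chamber₁ k zero    b (suc d) = sym (chamber-a1 (2 + k) (2 + b) (suc d))
tailCount-chamber₁ k (suc a) b d = trans (sym (+-assoc (tailCount (suc k) a b d) _ _))
  (trans (cong (_+ δ₀ d (suc a) b) (tailCount-chamber (suc k) a b d))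
    (trans (lem (chamber (3 + k) (1 + a) (2 + b) d) _ _ _) (sym (chamber-step₂ (suc k) (suc a) b d))))
  where
  lem : ∀ x y z w → x + y + z + w ≡ x + w + y + z
  lem = solve-∀
tailCount-chamber₂ k       a zero    d = trans (chamber-b1 k (1 + a) (suc d)) (sym (chamber-b1 k (2 + a) (suc d)))
tailCount-chamber₂ zero    a (suc b) d = refl
tailCount-chamber₂ (suc k) a (suc b) d = tailCount-chamber k a b (suc d)
tailCount-chamber₃ k a       b       zero                = refl
tailCount-chamber₃ k zero    zero    (suc zero)
  rewrite chamber-a1 (2 + k) 2 0 | chamber-b1 k 1 1 | chamber-b1 k 2 1 = refl
tailCount-chamber₃ k zero    zero    (suc (suc d))       = tailCount-chamber k zero zero (suc d)
tailCount-chamber₃ k zero    (suc b) (suc zero)          = tailCount-chamber k zero (suc b) zero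
tailCount-chamber₃ k zero    (suc b) (suc (suc d))       = tailCount-chamber k zero (suc b) (suc d)
tailCount-chamber₃ k (suc a) zero    (suc zero)          = tailCount-chamber k (suc a) zero zero
tailCount-chamber₃ k (suc a) (suc b) (suc zero)          = tailCount-chamber k (suc a) (suc b) zero
tailCount-chamber₃ k (suc a) b       (suc (suc d))       = tailCount-chamber k (suc a) b (suc d)

-- The closed form and its recursion

-- The binomial coefficient of a − 2 + ℓ over a − 2.
binom₋₂ : ℕ → ℕ → ℕ
binom₋₂ zero          ℓ = 0
binom₋₂ (suc zero)    ℓ = 0
binom₋₂ (suc (suc a)) ℓ = (a + ℓ) C a

binom₋₂-pascal : ∀ a ℓ → binom₋₂ a (suc ℓ) ≡ prec a (λ a′ → binom₋₂ a′ (suc ℓ)) + binom₋₂ a ℓ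
binom₋₂-pascal zero                ℓ = refl
binom₋₂-pascal (suc zero)          ℓ = refl
binom₋₂-pascal (suc (suc zero))    ℓ = refl
binom₋₂-pascal (suc (suc (suc a))) ℓ = begin
  (suc a + suc ℓ) C suc a                    ≡⟨ cong (_C suc a) (+-suc (suc a) ℓ) ⟩
  suc (suc a + ℓ) C suc a                    ≡⟨ nCk+nC[k+1]≡[n+1]C[k+1] (suc a + ℓ) a ⟨
  (suc a + ℓ) C a + (suc a + ℓ) C suc a      ≡⟨ cong (λ x → x C a + (suc a + ℓ) C suc a) (+-suc a ℓ) ⟨
  (a + suc ℓ) C a + (suc a + ℓ) C suc a      ∎
  where open ≡-Reasoning

-- Standard Young tableaux of shape (b + e, b), by the row of the largest entry.
syt : ℕ → ℕ → ℕ
syt zero    e       = 1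
syt (suc b) zero    = syt b 1
syt (suc b) (suc e) = syt b (suc (suc e)) + syt (suc b) e

target : ℕ → ℕ → ℕ → ℕ
target a b e = binom₋₂ a (b + b + e) * syt b e

-- The recursion has the same shape as that of `wordCount`. Pascal's rule splits off a first letter
-- 1; for 2 and 3 the recursion of `syt` applies, because the ballot word is read backwards and its
-- first letter thus stands for the largest entry of the tableau.
target-step : ∀ a b e →
  target a (suc b) e ≡ (prec a (λ a′ → target a′ (suc b) e) + target a b (suc e)) + prec e (target a (suc b))
target-step a b e = begin
  binom₋₂ a (suc b + suc b + e) * syt (suc b) e
    ≡⟨ cong (_* syt (suc b) e) (binom₋₂-pascal a (b + suc b + e)) ⟩
  (prec a (λ a′ → binom₋₂ a′ (suc (b + suc b + e))) + binom₋₂ a (b + suc b + e)) * syt (suc b) e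
    ≡⟨ *-distribʳ-+ (syt (suc b) e) (prec a (λ a′ → binom₋₂ a′ (suc (b + suc b + e)))) _ ⟩
  prec a (λ a′ → binom₋₂ a′ (suc (b + suc b + e))) * syt (suc b) e + binom₋₂ a (b + suc b + e) * syt (suc b) e
    ≡⟨ cong₂ _+_ (first a) (rest e) ⟩
  prec a (λ a′ → target a′ (suc b) e) + (target a b (suc e) + prec e (target a (suc b)))
    ≡⟨ +-assoc (prec a (λ a′ → target a′ (suc b) e)) _ _ ⟨
  (prec a (λ a′ → target a′ (suc b) e) + target a b (suc e)) + prec e (target a (suc b)) ∎
  where
  open ≡-Reasoning
  first : ∀ a → prec a (λ a′ → binom₋₂ a′ (suc (b + suc b + e))) * syt (suc b) e ≡ prec a (λ a′ → target a′ (suc b) e)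
  first zero    = refl
  first (suc a) = refl
  len : ∀ b e → b + suc b + e ≡ b + b + suc e
  len = solve-∀
  len′ : ∀ b e → b + suc b + suc e ≡ suc b + suc b + e
  len′ = solve-∀
  rest : ∀ e → binom₋₂ a (b + suc b + e) * syt (suc b) e ≡ target a b (suc e) + prec e (target a (suc b))
  rest zero    rewrite len b 0 = sym (+-identityʳ _)
  rest (suc e) = trans (*-distribˡ-+ (binom₋₂ a (b + suc b + suc e)) (syt b (2 + e)) (syt (suc b) e))
    (cong₂ _+_ (cong (λ ℓ → binom₋₂ a ℓ * syt b (2 + e)) (len b (suc e)))
               (cong (λ ℓ → binom₋₂ a ℓ * syt (suc b) e) (len′ b e)))

binom₋₂-0 : ∀ a → binom₋₂ (2 + a) 0 ≡ 1
binom₋₂-0 a = trans (cong (_C a) (+-identityʳ a)) (nCn≡1 a)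

-- Without 2s the prefix and suffix conditions are void, so all words in 1 and 3 are counted.
chamber-binom₋₂ : ∀ κ a d → chamber (suc κ) a 2 d ≡ binom₋₂ a d
chamber-binom₋₂ κ zero                d       = refl
chamber-binom₋₂ κ (suc zero)          zero    = chamber-a1 (suc κ) 2 0
chamber-binom₋₂ κ (suc (suc zero))    zero    = cong₂ (λ x y → x + y + 1) (chamber-a1 (2 + κ) 2 0) (chamber-b1 κ 2 1)
chamber-binom₋₂ κ (suc (suc (suc a))) zero    = trans
  (cong₂ (λ x y → x + y + 0) (chamber-binom₋₂ (suc κ) (suc (suc a)) zero) (chamber-b1 κ (3 + a) 1))
  (trans (cong (λ x → x + 0 + 0) (binom₋₂-0 a)) (sym (binom₋₂-0 (suc a))))
chamber-binom₋₂ κ (suc a)             (suc d) = trans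
  (cong₂ _+_ (cong₂ _+_ (chamber-binom₋₂ (suc κ) a (suc d)) (chamber-b1 κ (suc a) (suc (suc d)))) (chamber-binom₋₂ κ (suc a) d))
  (trans (cong (_+ binom₋₂ (suc a) d) (+-identityʳ (binom₋₂ a (suc d)))) (sym (binom₋₂-pascal (suc a) d)))

-- The identity for all parameters and the case where it is closed

-- The images under f₁² f₂² in which 0, 1 or 2 of the 1 + k pending 1s become 2s are counted by
-- target − chamber (3 + k), chamber (2 + k) − chamber (1 + k) and chamber k, respectively.
wordCount-suc : ∀ k a b e →
  wordCount (suc k) a b e + (chamber (3 + k) a (2 + b) e + chamber (1 + k) (1 + a) (1 + b) (1 + e)) ≡
    target a b e + (chamber (2 + k) (1 + a) (1 + b) (1 + e) + chamber k (2 + a) b (2 + e))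
-- With no 1 pending, only the first of these three kinds of image occurs.
wordCount-zero : ∀ a b e → wordCount 0 a b e + chamber 2 a (2 + b) e ≡ target a b e
wordCount-suc₁ : ∀ k a b e →
  wordCount₁ (suc k) a b e +
    (prec a (λ a′ → chamber (4 + k) a′ (2 + b) e) + chamber (2 + k) a (1 + b) (1 + e)) ≡
  prec a (λ a′ → target a′ b e) + (chamber (3 + k) a (1 + b) (1 + e) + chamber (1 + k) (1 + a) b (2 + e))
wordCount-suc₃ : ∀ k a b e →
  wordCount₃ (suc k) a b e +
    (prec e (chamber (3 + k) a (2 + b)) + chamber (1 + k) (1 + a) (1 + b) e) ≡
  prec e (target a b) + (chamber (2 + k) (1 + a) (1 + b) e + chamber k (2 + a) b (1 + e))
wordCount-zero₁ : ∀ a b e →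
  wordCount₁ 0 a b e + (prec a (λ a′ → chamber 3 a′ (2 + b) e) + chamber 1 a (1 + b) (1 + e)) ≡
  prec a (λ a′ → target a′ b e) + chamber 2 a (1 + b) (1 + e)
wordCount-zero₃ : ∀ a b e →
  wordCount₃ 0 a b e + prec e (chamber 2 a (2 + b)) ≡ prec e (target a b)

wordCount-suc₁ k zero    b e = sym (chamber-a1 (1 + k) b (2 + e))
wordCount-suc₁ k (suc a) b e = wordCount-suc (suc k) a b e
wordCount-suc₃ k a zero zero    = trans (chamber-b1 (1 + k) (1 + a) 0)
  (sym (cong₂ _+_ (chamber-b1 (2 + k) (1 + a) 0) (chamber-b0 k (2 + a) 1)))
wordCount-suc₃ k a zero (suc e) = wordCount-suc k a zero e
-- The leading 2 starts the suffix Q and uses one pending 1; what follows it is a tail.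
wordCount-suc₃ k a (suc b) zero    = trans (tailCount-chamber k a b 0) (+-identityʳ _)
wordCount-suc₃ k a (suc b) (suc e) = wordCount-suc k a (suc b) e
wordCount-zero₁ zero    b e = refl
wordCount-zero₁ (suc a) b e = trans (wordCount-suc 0 a b e) (cong (target a b e +_) (+-identityʳ _))
wordCount-zero₃ a zero    zero    = refl
wordCount-zero₃ a zero    (suc e) = wordCount-zero a zero e
wordCount-zero₃ a (suc b) zero    = refl
wordCount-zero₃ a (suc b) (suc e) = wordCount-zero a (suc b) e

wordCount-zero a zero e = trans (chamber-binom₋₂ 1 a e) (sym (*-identityʳ _))
-- The added `y` is the correction term that the induction hypothesis for first letter 2 requires.
-- First letter 1 produces it on the other side, so it cancels.
wordCount-zero a (suc b) e = +-cancelʳ-≡ y _ _ (begin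
  (F₁ + F₂ + F₃) + chamber 2 a (3 + b) e + y ≡⟨ cong (λ z → (F₁ + F₂ + F₃) + z + y) (chamber-step 1 a (2 + b) e refl) ⟩
  (F₁ + F₂ + F₃) + (p₁ + p₂ + p₃) + y  ≡⟨ lem F₁ F₂ F₃ p₁ p₂ p₃ y ⟩
  (F₁ + (p₁ + p₂)) + (F₂ + y) + (F₃ + p₃)
    ≡⟨ cong₂ _+_ (cong₂ _+_ (wordCount-zero₁ a (suc b) e) (wordCount-zero a b (suc e))) (wordCount-zero₃ a (suc b) e) ⟩
  (v₁ + y) + v₂ + v₃ ≡⟨ lem′ v₁ v₂ v₃ y ⟩
  (v₁ + v₂ + v₃) + y ≡⟨ cong (_+ y) (target-step a b e) ⟨
  target a (suc b) e + y ∎)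
  where
  open ≡-Reasoning
  y F₁ F₂ F₃ p₁ p₂ p₃ v₁ v₂ v₃ : ℕ
  y  = chamber 2 a (2 + b) (1 + e)
  F₁ = wordCount₁ 0 a (suc b) e
  F₂ = wordCount 0 a b (suc e)
  F₃ = wordCount₃ 0 a (suc b) e
  p₁ = prec a (λ a′ → chamber 3 a′ (3 + b) e)
  p₂ = chamber 1 a (2 + b) (1 + e)
  p₃ = prec e (chamber 2 a (3 + b))
  v₁ = prec a (λ a′ → target a′ (suc b) e)
  v₂ = target a b (suc e)
  v₃ = prec e (target a (suc b))
  lem : ∀ F₁ F₂ F₃ p₁ p₂ p₃ y → (F₁ + F₂ + F₃) + (p₁ + p₂ + p₃) + y ≡ (F₁ + (p₁ + p₂)) + (F₂ + y) + (F₃ + p₃)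
  lem = solve-∀
  lem′ : ∀ v₁ v₂ v₃ y → (v₁ + y) + v₂ + v₃ ≡ (v₁ + v₂ + v₃) + y
  lem′ = solve-∀

wordCount-suc k a zero e = cong₂ _+_ (trans (chamber-binom₋₂ (2 + k) a e) (sym (*-identityʳ _)))
  (trans (chamber-b1 (1 + k) (1 + a) (1 + e))
    (sym (cong₂ _+_ (chamber-b1 (2 + k) (1 + a) (1 + e)) (chamber-b0 k (2 + a) (2 + e)))))
wordCount-suc k a (suc b) e = begin
  (F₁ + F₂ k + F₃) + (chamber (3 + k) a (3 + b) e + chamber (1 + k) (1 + a) (2 + b) (1 + e))
    ≡⟨ cong (λ z → (F₁ + F₂ k + F₃) + (z + chamber (1 + k) (1 + a) (2 + b) (1 + e))) (chamber-step (2 + k) a (2 + b) e refl) ⟩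
  (F₁ + F₂ k + F₃) + ((p₁ + p₂ + p₃) + (q₁ + q₂ + q₃))
    ≡⟨ lem F₁ (F₂ k) F₃ p₁ p₂ p₃ q₁ q₂ q₃ ⟩
  (F₁ + (p₁ + q₁)) + (F₂ k + (p₂ + q₂)) + (F₃ + (p₃ + q₃))
    ≡⟨ cong₂ (λ x z → x + (F₂ k + (p₂ + q₂)) + z) (wordCount-suc₁ k a (suc b) e) (wordCount-suc₃ k a (suc b) e) ⟩
  (v₁ + (r₁ + r₂)) + (F₂ k + (p₂ + q₂)) + (v₃ + (r₃ + s₃))
    ≡⟨ second k ⟩
  (v₁ + v₂ + v₃) + ((r₁ + r₂ + r₃) + chamber k (2 + a) (1 + b) (2 + e))
    ≡⟨ cong (_+ ((r₁ + r₂ + r₃) + chamber k (2 + a) (1 + b) (2 + e))) (target-step a b e) ⟨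
  target a (suc b) e + ((r₁ + r₂ + r₃) + chamber k (2 + a) (1 + b) (2 + e)) ∎
  where
  open ≡-Reasoning
  F₂ : ℕ → ℕ
  F₂ k = wordCount k a b (suc e)
  F₁ F₃ p₁ p₂ p₃ q₁ q₂ q₃ r₁ r₂ r₃ s₃ v₁ v₂ v₃ : ℕ
  F₁ = wordCount₁ (suc k) a (suc b) e
  F₃ = wordCount₃ (suc k) a (suc b) e
  p₁ = prec a (λ a′ → chamber (4 + k) a′ (3 + b) e)
  p₂ = chamber (2 + k) a (2 + b) (1 + e)
  p₃ = prec e (chamber (3 + k) a (3 + b))
  q₁ = chamber (2 + k) a (2 + b) (1 + e)
  q₂ = chamber k (1 + a) (1 + b) (2 + e)
  q₃ = chamber (1 + k) (1 + a) (2 + b) e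
  r₁ = chamber (3 + k) a (2 + b) (1 + e)
  r₂ = chamber (1 + k) (1 + a) (1 + b) (2 + e)
  r₃ = chamber (2 + k) (1 + a) (2 + b) e
  s₃ = chamber k (2 + a) (1 + b) (1 + e)
  v₁ = prec a (λ a′ → target a′ (suc b) e)
  v₂ = target a b (suc e)
  v₃ = prec e (target a (suc b))
  lem : ∀ F₁ F₂ F₃ p₁ p₂ p₃ q₁ q₂ q₃ → (F₁ + F₂ + F₃) + ((p₁ + p₂ + p₃) + (q₁ + q₂ + q₃))
    ≡ (F₁ + (p₁ + q₁)) + (F₂ + (p₂ + q₂)) + (F₃ + (p₃ + q₃))
  lem = solve-∀
  lem₀ : ∀ v₁ r₁ r₂ v₂ v₃ r₃ → (v₁ + (r₁ + r₂)) + v₂ + (v₃ + (r₃ + 0)) ≡ (v₁ + v₂ + v₃) + ((r₁ + r₂ + r₃) + 0)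
  lem₀ = solve-∀
  lem₁ : ∀ v₁ r₁ r₂ v₂ r s v₃ r₃ s₃ →
    (v₁ + (r₁ + r₂)) + (v₂ + (r + s)) + (v₃ + (r₃ + s₃)) ≡ (v₁ + v₂ + v₃) + ((r₁ + r + r₃) + (r₂ + s + s₃))
  lem₁ = solve-∀
  -- A first letter 2 consumes one pending 1, so the induction hypothesis is `wordCount-zero` if
  -- none remains and `wordCount-suc` otherwise. In the former case the terms `chamber 0` are zero
  -- by definition.
  second : ∀ k →
    (v₁ + (chamber (3 + k) a (2 + b) (1 + e) + chamber (1 + k) (1 + a) (1 + b) (2 + e)))
      + (F₂ k + (chamber (2 + k) a (2 + b) (1 + e) + chamber k (1 + a) (1 + b) (2 + e)))
      + (v₃ + (chamber (2 + k) (1 + a) (2 + b) e + chamber k (2 + a) (1 + b) (1 + e))) ≡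
    (v₁ + v₂ + v₃) +
      ((chamber (3 + k) a (2 + b) (1 + e) + chamber (1 + k) (1 + a) (1 + b) (2 + e) + chamber (2 + k) (1 + a) (2 + b) e)
      + chamber k (2 + a) (1 + b) (2 + e))
  second zero    = trans
    (cong (λ x → (v₁ + (chamber 3 a (2 + b) (1 + e) + chamber 1 (1 + a) (1 + b) (2 + e))) + x + (v₃ + (chamber 2 (1 + a) (2 + b) e + 0)))
      (trans (cong (F₂ 0 +_) (+-identityʳ _)) (wordCount-zero a b (suc e))))
    (lem₀ v₁ (chamber 3 a (2 + b) (1 + e)) (chamber 1 (1 + a) (1 + b) (2 + e)) v₂ v₃ _)
  second (suc k) = trans
    (cong (λ x → (v₁ + (chamber (4 + k) a (2 + b) (1 + e) + chamber (2 + k) (1 + a) (1 + b) (2 + e))) + x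
        + (v₃ + (chamber (3 + k) (1 + a) (2 + b) e + chamber (suc k) (2 + a) (1 + b) (1 + e))))
      (wordCount-suc k a b (suc e)))
    (lem₁ v₁ (chamber (4 + k) a (2 + b) (1 + e)) (chamber (2 + k) (1 + a) (1 + b) (2 + e)) v₂ _ _ v₃ _ _)

wordCount-closed : ∀ k a b e → k + a < b → wordCount k a b e ≡ target a b e
wordCount-closed zero    a b e p = trans (sym (+-identityʳ _))
  (trans (cong (wordCount 0 a b e +_) (sym (chamber-vanish 2 a (2 + b) e (s≤s (s≤s (<⇒≤ p)))))) (wordCount-zero a b e))
wordCount-closed (suc k) a b e p = begin
  wordCount (suc k) a b e
    ≡⟨ +-identityʳ _ ⟨
  wordCount (suc k) a b e + 0
    ≡⟨ cong (wordCount (suc k) a b e +_) (cong₂ _+_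
         (chamber-vanish (3 + k) a (2 + b) e (s≤s (s≤s (<⇒≤ p))))
         (chamber-vanish (1 + k) (1 + a) (1 + b) (1 + e) (s≤s (≤-trans (≤-reflexive (+-suc k a)) (<⇒≤ p))))) ⟨
  wordCount (suc k) a b e + (chamber (3 + k) a (2 + b) e + chamber (1 + k) (1 + a) (1 + b) (1 + e))
    ≡⟨ wordCount-suc k a b e ⟩
  target a b e + (chamber (2 + k) (1 + a) (1 + b) (1 + e) + chamber k (2 + a) b (2 + e))
    ≡⟨ cong (target a b e +_) (cong₂ _+_
         (chamber-vanish (2 + k) (1 + a) (1 + b) (1 + e) (s≤s (≤-trans (≤-reflexive (cong suc (+-suc k a))) p)))
         (chamber-vanish k (2 + a) b (2 + e) (≤-trans (≤-reflexive (trans (+-suc k (suc a)) (cong suc (+-suc k a)))) p))) ⟩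
  target a b e + 0
    ≡⟨ +-identityʳ _ ⟩
  target a b e ∎
  where open ≡-Reasoning

-- Sums over words

⟦_⟧ : Bool → ℕ
⟦ true ⟧  = 1
⟦ false ⟧ = 0

total : {X : Set} → (X → ℕ) → List X → ℕ
total g []       = 0
total g (x ∷ xs) = g x + total g xs

wsum : {X : Set} → List X → (List X → ℕ) → ℕ → ℕ
wsum al g zero    = g []
wsum al g (suc N) = total (λ x → wsum al (λ w → g (x ∷ w)) N) al

module _ {X : Set} where

  total-cong : {g h : X → ℕ} → (∀ x → g x ≡ h x) → ∀ L → total g L ≡ total h L
  total-cong eq []       = refl
  total-cong eq (x ∷ xs) = cong₂ _+_ (eq x) (total-cong eq xs)

  total-+ : (g h : X → ℕ) → ∀ L → total (λ x → g x + h x) L ≡ total g L + total h L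
  total-+ g h []       = refl
  total-+ g h (x ∷ xs) = trans (cong (g x + h x +_) (total-+ g h xs)) (lem (g x) (h x) _ _)
    where
    lem : ∀ a b c d → a + b + (c + d) ≡ a + c + (b + d)
    lem = solve-∀

  total-0 : ∀ (L : List X) → total (λ _ → 0) L ≡ 0
  total-0 []       = refl
  total-0 (x ∷ xs) = total-0 xs

  total-++ : (g : X → ℕ) → ∀ L M → total g (L ++ M) ≡ total g L + total g M
  total-++ g []       M = refl
  total-++ g (x ∷ xs) M = trans (cong (g x +_) (total-++ g xs M)) (sym (+-assoc (g x) _ _))

  length-filterᵇ : (p : X → Bool) → ∀ L → length (filterᵇ p L) ≡ total (λ x → ⟦ p x ⟧) L
  length-filterᵇ p []       = refl
  length-filterᵇ p (x ∷ xs) with p x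
  ... | true  = cong suc (length-filterᵇ p xs)
  ... | false = length-filterᵇ p xs

module _ {X Y : Set} where

  total-map : (g : Y → ℕ) (h : X → Y) → ∀ L → total g (map h L) ≡ total (λ x → g (h x)) L
  total-map g h []       = refl
  total-map g h (x ∷ xs) = cong (g (h x) +_) (total-map g h xs)

  total-concatMap : (g : Y → ℕ) (h : X → List Y) → ∀ L →
    total g (concatMap h L) ≡ total (λ x → total g (h x)) L
  total-concatMap g h []       = refl
  total-concatMap g h (x ∷ xs) =
    trans (total-++ g (h x) _) (cong (total g (h x) +_) (total-concatMap g h xs))

  total-swap : (h : X → Y → ℕ) → ∀ L M →
    total (λ x → total (h x) M) L ≡ total (λ y → total (λ x → h x y) L) M
  total-swap h []       M = sym (total-0 M)
  total-swap h (x ∷ xs) M =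
    trans (cong (total (h x) M +_) (total-swap h xs M)) (sym (total-+ (h x) _ M))

module _ {X : Set} (al : List X) where

  -- `allWords` varies the first letter innermost while `wsum` splits on it outermost; exchanging
  -- the two sums reconciles them.
  total-allWords : (g : List X → ℕ) → ∀ N → total g (allWords al N) ≡ wsum al g N
  total-allWords g zero    = +-identityʳ (g [])
  total-allWords g (suc N) = begin
    total g (concatMap (λ w → map (λ a → a ∷ w) al) (allWords al N))
      ≡⟨ total-concatMap g _ (allWords al N) ⟩
    total (λ w → total g (map (λ a → a ∷ w) al)) (allWords al N)
      ≡⟨ total-cong (λ w → total-map g (λ a → a ∷ w) al) (allWords al N) ⟩
    total (λ w → total (λ a → g (a ∷ w)) al) (allWords al N)
      ≡⟨ total-swap (λ w a → g (a ∷ w)) (allWords al N) al ⟩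
    total (λ a → total (λ w → g (a ∷ w)) (allWords al N)) al
      ≡⟨ total-cong (λ a → total-allWords (λ w → g (a ∷ w)) N) al ⟩
    wsum al g (suc N) ∎
    where open ≡-Reasoning

  count-allWords : (p : List X → Bool) → ∀ N →
    length (filterᵇ p (allWords al N)) ≡ wsum al (λ w → ⟦ p w ⟧) N
  count-allWords p N = trans (length-filterᵇ p (allWords al N)) (total-allWords _ N)

  wsum-cong : {g h : List X → ℕ} → (∀ w → g w ≡ h w) → ∀ N → wsum al g N ≡ wsum al h N
  wsum-cong eq zero    = eq []
  wsum-cong eq (suc N) = total-cong (λ x → wsum-cong (λ w → eq (x ∷ w)) N) al

  wsum-+ : (g h : List X → ℕ) → ∀ N → wsum al (λ w → g w + h w) N ≡ wsum al g N + wsum al h N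
  wsum-+ g h zero    = refl
  wsum-+ g h (suc N) = trans (total-cong (λ x → wsum-+ (λ w → g (x ∷ w)) (λ w → h (x ∷ w)) N) al)
    (total-+ (λ x → wsum al (λ w → g (x ∷ w)) N) _ al)

  wsum-0 : ∀ N → wsum al (λ _ → 0) N ≡ 0
  wsum-0 zero    = refl
  wsum-0 (suc N) = trans (total-cong (λ x → wsum-0 N) al) (total-0 al)

-- Words of given content

rows : List Row
rows = r1 ∷ r2 ∷ r3 ∷ []

content : List Row → ℕ → ℕ → ℕ → Bool
content []       a       b       c       = (0 ≡ᵇ a) ∧ (0 ≡ᵇ b) ∧ (0 ≡ᵇ c)
content (r1 ∷ w) zero    b       c       = false
content (r1 ∷ w) (suc a) b       c       = content w a b c
content (r2 ∷ w) a       zero    c       = false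
content (r2 ∷ w) a       (suc b) c       = content w a b c
content (r3 ∷ w) a       b       zero    = false
content (r3 ∷ w) a       b       (suc c) = content w a b c

count : (List Row → Bool) → ℕ → ℕ → ℕ → ℕ → ℕ
count P N a b c = wsum rows (λ w → ⟦ content w a b c ∧ P w ⟧) N

count-step : ∀ P N a b c → count P (suc N) a b c ≡
  (prec a (λ a′ → count (λ w → P (r1 ∷ w)) N a′ b c) + prec b (λ b′ → count (λ w → P (r2 ∷ w)) N a b′ c))
  + prec c (λ c′ → count (λ w → P (r3 ∷ w)) N a b c′)
count-step P N a b c = trans (lem (wsum rows (λ w → ⟦ content (r1 ∷ w) a b c ∧ P (r1 ∷ w) ⟧) N) _ _)
  (cong₂ _+_ (cong₂ _+_ (p₁ a) (p₂ b)) (p₃ c))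
  where
  lem : ∀ x y z → x + (y + (z + 0)) ≡ x + y + z
  lem = solve-∀
  p₁ : ∀ a → wsum rows (λ w → ⟦ content (r1 ∷ w) a b c ∧ P (r1 ∷ w) ⟧) N ≡ prec a (λ a′ → count (λ w → P (r1 ∷ w)) N a′ b c)
  p₁ zero    = wsum-0 rows N
  p₁ (suc a) = refl
  p₂ : ∀ b → wsum rows (λ w → ⟦ content (r2 ∷ w) a b c ∧ P (r2 ∷ w) ⟧) N ≡ prec b (λ b′ → count (λ w → P (r2 ∷ w)) N a b′ c)
  p₂ zero    = wsum-0 rows N
  p₂ (suc b) = refl
  p₃ : ∀ c → wsum rows (λ w → ⟦ content (r3 ∷ w) a b c ∧ P (r3 ∷ w) ⟧) N ≡ prec c (λ c′ → count (λ w → P (r3 ∷ w)) N a b c′)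
  p₃ zero    = wsum-0 rows N
  p₃ (suc c) = refl

count-+ : ∀ {P Q R} N a b c → (∀ w → content w a b c ≡ true → ⟦ P w ⟧ ≡ ⟦ Q w ⟧ + ⟦ R w ⟧) →
  count P N a b c ≡ count Q N a b c + count R N a b c
count-+ {P} {Q} {R} N a b c eq = trans (wsum-cong rows pointwise N) (wsum-+ rows _ _ N)
  where
  pointwise : ∀ w → ⟦ content w a b c ∧ P w ⟧ ≡ ⟦ content w a b c ∧ Q w ⟧ + ⟦ content w a b c ∧ R w ⟧
  pointwise w with content w a b c in h
  ... | true  = eq w h
  ... | false = refl

count-false : ∀ N a b c → count (λ _ → false) N a b c ≡ 0
count-false N a b c = trans (wsum-cong rows (λ w → cong ⟦_⟧ (∧-zeroʳ (content w a b c))) N) (wsum-0 rows N)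

count-cong : ∀ {P Q} N a b c → (∀ w → content w a b c ≡ true → P w ≡ Q w) → count P N a b c ≡ count Q N a b c
count-cong {P} {Q} N a b c eq = wsum-cong rows pointwise N
  where
  pointwise : ∀ w → ⟦ content w a b c ∧ P w ⟧ ≡ ⟦ content w a b c ∧ Q w ⟧
  pointwise w with content w a b c in h
  ... | true  = cong ⟦_⟧ (eq w h)
  ... | false = refl

count-empty : ∀ {P} N a b c → (∀ w → content w a b c ≡ true → P w ≡ false) → count P N a b c ≡ 0
count-empty N a b c eq = trans (count-cong N a b c eq) (count-false N a b c)

-- Acceptance conditions on words

-- Reading the word from right to left, every 2 takes an available 3 to its right:
-- avail is the number of 3s left over, overflow the number of 2s that find none.
avail overflow : List Row → ℕ
avail []       = 0
avail (r1 ∷ w) = avail w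
avail (r2 ∷ w) = pred (avail w)
avail (r3 ∷ w) = suc (avail w)
overflow []       = 0
overflow (r1 ∷ w) = overflow w
overflow (r2 ∷ w) = if avail w ≡ᵇ 0 then suc (overflow w) else overflow w
overflow (r3 ∷ w) = overflow w

allMatched : ℕ → List Row → Bool
allMatched k       []       = true
allMatched k       (r1 ∷ w) = allMatched (suc k) w
allMatched zero    (r2 ∷ w) = false
allMatched (suc k) (r2 ∷ w) = allMatched k w
allMatched k       (r3 ∷ w) = allMatched k w

-- When overflow w = 1: the 2s of the shortest suffix with one more 2 than 3s are all matched
-- by 1s on their left, k further 1s being pending.
critMatched : ℕ → List Row → Bool
critMatched k []       = false
critMatched k (r1 ∷ w) = critMatched (suc k) w
critMatched k (r2 ∷ w) = if overflow w ≡ᵇ 0 then allMatched k (r2 ∷ w) else critMatched (pred k) w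
critMatched k (r3 ∷ w) = critMatched k w

-- `accepts₀` and `accepts₁` consume the prefix of the form 1^i 3 1^j 3, with k counting the 1s read
-- so far, and hand the remaining word to `suffixAccepts`.
tailAccepts suffixAccepts accepts₁ accepts₀ : ℕ → List Row → Bool
tailAccepts k w = lastIs3 w ∧ (overflow w ≡ᵇ 0) ∧ allMatched k w
suffixAccepts k w = lastIs3 w ∧ (overflow w ≡ᵇ 1) ∧ critMatched k w
accepts₁ k []       = false
accepts₁ k (r1 ∷ w) = accepts₁ (suc k) w
accepts₁ k (r2 ∷ w) = false
accepts₁ k (r3 ∷ w) = suffixAccepts k w
accepts₀ k []       = false
accepts₀ k (r1 ∷ w) = accepts₀ (suc k) w
accepts₀ k (r2 ∷ w) = false
accepts₀ k (r3 ∷ w) = accepts₁ k w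

-- Accepted words satisfy the first-letter recursions

lastIs3-r1 : ∀ w → lastIs3 (r1 ∷ w) ≡ lastIs3 w
lastIs3-r1 []      = refl
lastIs3-r1 (_ ∷ w) = refl

lastIs3-r2 : ∀ w → lastIs3 (r2 ∷ w) ≡ lastIs3 w
lastIs3-r2 []      = refl
lastIs3-r2 (_ ∷ w) = refl

-- The matched 2s are as many as the matched 3s.
avail-overflow : ∀ w a b c → content w a b c ≡ true → avail w + b ≡ overflow w + c
avail-overflow []       zero    zero    zero    h = refl
avail-overflow (r1 ∷ w) (suc a) b       c       h = avail-overflow w a b c h
avail-overflow (r2 ∷ w) a       (suc b) c       h with avail w | avail-overflow w a b c h
... | zero  | eq = cong suc eq
... | suc v | eq = trans (+-suc v b) eq
avail-overflow (r3 ∷ w) a       b       (suc c) h =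
  trans (cong suc (avail-overflow w a b c h)) (sym (+-suc (overflow w) c))

overflow-b0 : ∀ w a c → content w a 0 c ≡ true → overflow w ≡ 0
overflow-b0 []       a       c       h = refl
overflow-b0 (r1 ∷ w) (suc a) c       h = overflow-b0 w a c h
overflow-b0 (r3 ∷ w) a       (suc c) h = overflow-b0 w a c h

lastIs3-r3 : ∀ w a b c → 0 < a + b + c → content w a b c ≡ true → lastIs3 (r3 ∷ w) ≡ lastIs3 w
lastIs3-r3 []      zero zero zero () h
lastIs3-r3 (_ ∷ w) a    b    c    p  h = refl

length-r2 : ∀ a b c {N} → suc N ≡ a + suc b + c → N ≡ a + b + c
length-r2 a b c eq = suc-injective (trans eq (cong (_+ c) (+-suc a b)))

length-r3 : ∀ a b c {N} → suc N ≡ a + b + suc c → N ≡ a + b + c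
length-r3 a b c eq = suc-injective (trans eq (+-suc (a + b) c))

avail≡overflow+d : ∀ w a b d → content w a b (b + d) ≡ true → avail w ≡ overflow w + d
avail≡overflow+d w a b d h = +-cancelʳ-≡ b _ _ (trans (avail-overflow w a b (b + d) h) (lem (overflow w) b d))
  where
  lem : ∀ o b d → o + (b + d) ≡ o + d + b
  lem = solve-∀

count-tailAccepts : ∀ N k a b d → N ≡ a + b + (b + d) → count (tailAccepts k) N a b (b + d) ≡ tailCount k a b d
count-tailAccepts zero    k zero    zero zero _ = refl
count-tailAccepts (suc N) k a b d eq = trans (count-step (tailAccepts k) N a b (b + d))
  (cong₂ _+_ (cong₂ _+_ (p₁ a eq) (p₂ k b eq)) (p₃ d eq))
  where
  p₁ : ∀ a → suc N ≡ a + b + (b + d) →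
    prec a (λ a′ → count (λ w → tailAccepts k (r1 ∷ w)) N a′ b (b + d)) ≡ tailCount₁ k a b d
  p₁ zero    eq = refl
  p₁ (suc a) eq = trans
    (count-cong N a b (b + d) (λ w _ → cong (_∧ ((overflow w ≡ᵇ 0) ∧ allMatched (suc k) w)) (lastIs3-r1 w)))
    (count-tailAccepts N (suc k) a b d (suc-injective eq))
  p₂ : ∀ k b → suc N ≡ a + b + (b + d) →
    prec b (λ b′ → count (λ w → tailAccepts k (r2 ∷ w)) N a b′ (b + d)) ≡ tailCount₂ k a b d
  p₂ k       zero    eq = refl
  p₂ zero    (suc b) eq = count-empty N a b (suc b + d)
    (λ w _ → trans (cong (lastIs3 (r2 ∷ w) ∧_) (∧-zeroʳ _)) (∧-zeroʳ _))
  p₂ (suc k) (suc b) eq = trans (cong (count _ N a b) (sym (+-suc b d))) (trans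
    (count-cong N a b (b + suc d) pointwise)
    (count-tailAccepts N k a b (suc d) (trans (length-r2 a b (suc b + d) eq) (cong (a + b +_) (sym (+-suc b d))))))
    where
    pointwise : ∀ w → content w a b (b + suc d) ≡ true → tailAccepts (suc k) (r2 ∷ w) ≡ tailAccepts k w
    -- The rest of the word has a surplus of 3s, so the leading 2 finds a partner and adds nothing
    -- to the overflow.
    pointwise w h rewrite lastIs3-r2 w | avail≡overflow+d w a b (suc d) h | +-suc (overflow w) d = refl
  p₃ : ∀ d → suc N ≡ a + b + (b + d) →
    prec (b + d) (λ c′ → count (λ w → tailAccepts k (r3 ∷ w)) N a b c′) ≡ tailCount₃ k a b d
  p₃ zero    eq = none b
    where
    none : ∀ b → prec (b + 0) (λ c′ → count (λ w → tailAccepts k (r3 ∷ w)) N a b c′) ≡ 0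
    none zero    = refl
    -- After the leading 3 there are fewer 3s than 2s, which forces a positive overflow.
    none (suc b) = count-empty N a (suc b) (b + 0) pointwise
      where
      pointwise : ∀ w → content w a (suc b) (b + 0) ≡ true → tailAccepts k (r3 ∷ w) ≡ false
      pointwise w h with overflow w | avail-overflow w a (suc b) (b + 0) h
      ... | suc _ | _ = ∧-zeroʳ _
      ... | zero  | q = ⊥-elim (<-irrefl refl (≤-trans (m≤n+m (suc b) (avail w))
                          (≤-reflexive (trans q (+-identityʳ b)))))
  p₃ (suc d) eq rewrite +-suc b d = some a b d (length-r3 a b (b + d) eq)
    where
    cut : ∀ a b d → 0 < a + b + (b + d) → N ≡ a + b + (b + d) →
      count (λ w → tailAccepts k (r3 ∷ w)) N a b (b + d) ≡ tailCount k a b d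
    cut a b d pos eq = trans
      (count-cong N a b (b + d) (λ w h → cong (_∧ ((overflow w ≡ᵇ 0) ∧ allMatched k w)) (lastIs3-r3 w a b (b + d) pos h)))
      (count-tailAccepts N k a b d eq)
    some : ∀ a b d → N ≡ a + b + (b + d) →
      count (λ w → tailAccepts k (r3 ∷ w)) N a b (b + d) ≡ tailCount₃ k a b (suc d)
    -- The word is the single letter 3, the one case where this letter itself is the required final
    -- 3.
    some zero    zero    zero    refl = refl
    some zero    zero    (suc d) eq   = cut zero zero (suc d) (s≤s z≤n) eq
    some zero    (suc b) d       eq   = cut zero (suc b) d (s≤s z≤n) eq
    some (suc a) b       d       eq   = cut (suc a) b d (s≤s z≤n) eq

count-suffixAccepts : ∀ N k a b e c → suc c ≡ b + e → N ≡ a + b + c → count (suffixAccepts k) N a b c ≡ wordCount k a b e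
count-suffixAccepts N       k a zero    e c ce eq = count-empty N a 0 c pointwise
  where
  pointwise : ∀ w → content w a 0 c ≡ true → suffixAccepts k w ≡ false
  pointwise w h rewrite overflow-b0 w a c h = ∧-zeroʳ (lastIs3 w)
count-suffixAccepts zero    k a (suc b) e c ce eq with trans eq (cong (_+ c) (+-suc a b))
... | ()
count-suffixAccepts (suc N) k a (suc b) e c ce eq = begin
  count (suffixAccepts k) (suc N) a (suc b) c
    ≡⟨ count-step (suffixAccepts k) N a (suc b) c ⟩
  x₁ + count (λ w → suffixAccepts k (r2 ∷ w)) N a b c + x₃ c
    ≡⟨ cong₂ (λ x y → x + y + x₃ c) (p₁ a eq)
         (trans (count-+ {Q = suffixAccepts (pred k)} {R = R k e} N a b c p₂)
                (cong (_+ count (R k e) N a b c) (count-suffixAccepts N (pred k) a b (suc e) c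
                  (trans ce (sym (+-suc b e))) (length-r2 a b c eq)))) ⟩
  wordCount₁ k a (suc b) e + (wordCount (pred k) a b (suc e) + count (R k e) N a b c) + x₃ c
    ≡⟨ lem (wordCount₁ k a (suc b) e) _ _ _ ⟩
  wordCount₁ k a (suc b) e + wordCount (pred k) a b (suc e) + (count (R k e) N a b c + x₃ c)
    ≡⟨ cong (wordCount₁ k a (suc b) e + wordCount (pred k) a b (suc e) +_) (p₃ k e c ce eq refl) ⟩
  wordCount k a (suc b) e ∎
  where
  open ≡-Reasoning
  lem : ∀ x y z u → x + (y + z) + u ≡ x + y + (z + u)
  lem = solve-∀
  x₁ : ℕ
  x₁ = prec a (λ a′ → count (λ w → suffixAccepts k (r1 ∷ w)) N a′ (suc b) c)
  x₃ : ℕ → ℕ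
  x₃ c = prec c (λ c′ → count (λ w → suffixAccepts k (r3 ∷ w)) N a (suc b) c′)
  -- The words whose leading 2 is itself the overflow and so starts Q: it needs a pending 1, and no
  -- 3 is left over behind it, so e = 0. In that case a leading 3 is impossible (`none`), and this
  -- contribution takes the slot `wordCount₃`.
  R : ℕ → ℕ → List Row → Bool
  R (suc k) zero    w = tailAccepts k w
  R k       _       w = false
  p₁ : ∀ a → suc N ≡ a + suc b + c →
    prec a (λ a′ → count (λ w → suffixAccepts k (r1 ∷ w)) N a′ (suc b) c) ≡ wordCount₁ k a (suc b) e
  p₁ zero    eq = refl
  p₁ (suc a) eq = trans
    (count-cong N a (suc b) c (λ w _ → cong (_∧ ((overflow w ≡ᵇ 1) ∧ critMatched (suc k) w)) (lastIs3-r1 w)))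
    (count-suffixAccepts N (suc k) a (suc b) e c ce (suc-injective eq))
  p₂ : ∀ w → content w a b c ≡ true → ⟦ suffixAccepts k (r2 ∷ w) ⟧ ≡ ⟦ suffixAccepts (pred k) w ⟧ + ⟦ R k e w ⟧
  p₂ w h = split k e (avail≡overflow+d w a b e (subst (λ c → content w a b c ≡ true) (suc-injective ce) h))
    where
    split : ∀ k e → avail w ≡ overflow w + e → ⟦ suffixAccepts k (r2 ∷ w) ⟧ ≡ ⟦ suffixAccepts (pred k) w ⟧ + ⟦ R k e w ⟧
    split zero e v rewrite lastIs3-r2 w with lastIs3 w
    ... | false = refl
    ... | true with overflow w | avail w
    split zero zero    refl | true | zero        | _ = refl
    split zero (suc e) refl | true | zero        | _ = refl
    split zero e       refl | true | suc zero    | _ = sym (+-identityʳ _)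
    split zero e       refl | true | suc (suc o) | _ = refl
    split (suc k) zero v rewrite lastIs3-r2 w with lastIs3 w
    ... | false = refl
    ... | true with overflow w | avail w
    split (suc k) zero refl | true | zero        | _ = refl
    split (suc k) zero refl | true | suc zero    | _ = sym (+-identityʳ _)
    split (suc k) zero refl | true | suc (suc o) | _ = refl
    split (suc k) (suc e) v rewrite lastIs3-r2 w with lastIs3 w
    ... | false = refl
    ... | true with overflow w | avail w
    split (suc k) (suc e) refl | true | zero        | _ = refl
    split (suc k) (suc e) refl | true | suc zero    | _ = sym (+-identityʳ _)
    split (suc k) (suc e) refl | true | suc (suc o) | _ = refl
  none : ∀ c → suc c ≡ suc b + 0 → x₃ c ≡ 0
  none zero    ce = refl
  none (suc c) ce = count-empty N a (suc b) c pointwise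
    where
    pointwise : ∀ w → content w a (suc b) c ≡ true → suffixAccepts k (r3 ∷ w) ≡ false
    pointwise w h with overflow w | avail-overflow w a (suc b) c h
    ... | zero        | _ = ∧-zeroʳ _
    ... | suc (suc _) | _ = ∧-zeroʳ _
    ... | suc zero    | q = ⊥-elim (<-irrefl refl (≤-trans (m≤n+m (suc b) (avail w))
                              (≤-reflexive (trans q (trans (suc-injective ce) (+-identityʳ b))))))
  p₃ : ∀ k′ e c → suc c ≡ suc b + e → suc N ≡ a + suc b + c → k ≡ k′ →
    count (R k′ e) N a b c + x₃ c ≡ wordCount₃ k′ a (suc b) e
  p₃ zero    zero    c ce eq _ = cong₂ _+_ (count-false N a b c) (none c ce)
  p₃ (suc k) zero    c ce eq _ = trans (cong₂ _+_
    (trans (cong (count (tailAccepts k) N a b) (suc-injective ce))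
      (count-tailAccepts N k a b 0 (trans (length-r2 a b c eq) (cong (a + b +_) (suc-injective ce)))))
    (none c ce)) (+-identityʳ _)
  p₃ k′      (suc e) zero    ce eq _ with trans ce (+-suc (suc b) e)
  ... | ()
  p₃ k′      (suc e) (suc c) ce eq refl = trans (cong₂ _+_
    (R-suc k′)
    (trans (count-cong N a (suc b) c (λ w h → cong (_∧ ((overflow w ≡ᵇ 1) ∧ critMatched k w))
             (lastIs3-r3 w a (suc b) c (≤-trans (s≤s z≤n) (≤-reflexive (sym (cong (_+ c) (+-suc a b))))) h)))
           (count-suffixAccepts N k a (suc b) e c (suc-injective (trans ce (+-suc (suc b) e))) (length-r3 a (suc b) c eq))))
    (wordCount₃-suc k′)
    where
    R-suc : ∀ k → count (R k (suc e)) N a b (suc c) ≡ 0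
    R-suc zero    = count-false N a b (suc c)
    R-suc (suc k) = count-false N a b (suc c)
    wordCount₃-suc : ∀ k → wordCount k a (suc b) e ≡ wordCount₃ k a (suc b) (suc e)
    wordCount₃-suc zero    = refl
    wordCount₃-suc (suc k) = refl

-- One Pascal step for each of the two 3s that must precede all 2s.
count-pascal : ∀ {P : ℕ → List Row → Bool} {Q : ℕ → List Row → Bool} {ℓ g b c} →
  (∀ k w → P k (r1 ∷ w) ≡ P (suc k) w) → (∀ k w → P k (r2 ∷ w) ≡ false) → (∀ k w → P k (r3 ∷ w) ≡ Q k w) →
  (∀ N k a → k + a < b → N ≡ a + b + c → count (Q k) N a b c ≡ binom₋₂ a ℓ * g) →
  ∀ N k a → k + a < b → N ≡ a + b + suc c → count (P k) N a b (suc c) ≡ binom₋₂ a (suc ℓ) * g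
count-pascal {P} {Q} {ℓ} {g} {b} {c} h₁ h₂ h₃ hQ zero    k a lt eq with trans eq (+-suc (a + b) c)
... | ()
count-pascal {P} {Q} {ℓ} {g} {b} {c} h₁ h₂ h₃ hQ (suc N) k a lt eq = begin
  count (P k) (suc N) a b (suc c)
    ≡⟨ count-step (P k) N a b (suc c) ⟩
  _ ≡⟨ cong₂ _+_ (cong₂ _+_ (p₁ a lt eq) (p₂ b)) p₃ ⟩
  prec a (λ a′ → binom₋₂ a′ (suc ℓ)) * g + 0 + binom₋₂ a ℓ * g
    ≡⟨ cong (_+ binom₋₂ a ℓ * g) (+-identityʳ _) ⟩
  prec a (λ a′ → binom₋₂ a′ (suc ℓ)) * g + binom₋₂ a ℓ * g
    ≡⟨ *-distribʳ-+ g (prec a (λ a′ → binom₋₂ a′ (suc ℓ))) (binom₋₂ a ℓ) ⟨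
  (prec a (λ a′ → binom₋₂ a′ (suc ℓ)) + binom₋₂ a ℓ) * g
    ≡⟨ cong (_* g) (binom₋₂-pascal a ℓ) ⟨
  binom₋₂ a (suc ℓ) * g ∎
  where
  open ≡-Reasoning
  p₁ : ∀ a → k + a < b → suc N ≡ a + b + suc c →
    prec a (λ a′ → count (λ w → P k (r1 ∷ w)) N a′ b (suc c)) ≡ prec a (λ a′ → binom₋₂ a′ (suc ℓ)) * g
  p₁ zero    lt eq = refl
  p₁ (suc a) lt eq = trans (count-cong N a b (suc c) (λ w _ → h₁ k w))
    (count-pascal {P} {Q} h₁ h₂ h₃ hQ N (suc k) a (subst (_< b) (+-suc k a) lt) (suc-injective eq))
  p₂ : ∀ b → prec b (λ b′ → count (λ w → P k (r2 ∷ w)) N a b′ (suc c)) ≡ 0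
  p₂ zero    = refl
  p₂ (suc b) = count-empty N a b (suc c) (λ w _ → h₂ k w)
  p₃ : count (λ w → P k (r3 ∷ w)) N a b c ≡ binom₋₂ a ℓ * g
  p₃ = trans (count-cong N a b c (λ w _ → h₃ k w)) (hQ N k a lt (length-r3 a b c eq))

count-accepts₀ : ∀ N a b e c → suc c ≡ b + e → a < b → N ≡ a + b + suc (suc c) →
  count (accepts₀ 0) N a b (suc (suc c)) ≡ binom₋₂ a (suc (suc (b + b + e))) * syt b e
count-accepts₀ N a b e c ce lt eq =
  count-pascal {accepts₀} {accepts₁} (λ _ _ → refl) (λ _ _ → refl) (λ _ _ → refl)
    (count-pascal {accepts₁} {suffixAccepts} (λ _ _ → refl) (λ _ _ → refl) (λ _ _ → refl)
      (λ N k a lt eq → trans (count-suffixAccepts N k a b e c ce eq) (wordCount-closed k a b e lt)))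
    N 0 a lt eq

-- Ballot words and two-row tableaux

ballot : ℕ → List TRow → Bool
ballot h       []        = true
ballot h       (top ∷ w) = ballot (suc h) w
ballot zero    (bot ∷ w) = false
ballot (suc h) (bot ∷ w) = ballot h w

ballots : ℕ → ℕ → ℕ → ℕ
ballots h       zero    zero    = 1
ballots zero    zero    (suc b) = 0
ballots (suc h) zero    (suc b) = ballots h zero b
ballots h       (suc a) zero    = ballots (suc h) a zero
ballots zero    (suc a) (suc b) = ballots 1 a (suc b)
ballots (suc h) (suc a) (suc b) = ballots (suc (suc h)) a (suc b) + ballots h (suc a) b

ballots-b0 : ∀ h a → ballots h a 0 ≡ 1
ballots-b0 h zero    = refl
ballots-b0 h (suc a) = ballots-b0 (suc h) a

ballots-vanish : ∀ h a b → h + a < b → ballots h a b ≡ 0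
ballots-vanish zero    zero    (suc b) p = refl
ballots-vanish (suc h) zero    (suc b) (s≤s p) = ballots-vanish h zero b p
ballots-vanish zero    (suc a) (suc b) p = ballots-vanish 1 a (suc b) p
ballots-vanish (suc h) (suc a) (suc b) (s≤s p) = cong₂ _+_
  (ballots-vanish (suc (suc h)) a (suc b) (s≤s (subst (_< b) (+-suc h a) p))) (ballots-vanish h (suc a) b p)

ballots-a0 : ∀ h b → b ≤ h → ballots h 0 b ≡ 1
ballots-a0 h       zero    p       = refl
ballots-a0 (suc h) (suc b) (s≤s p) = ballots-a0 h b p

-- ballots is defined by removing the first letter; this removes the last one.
ballots-last : ∀ h a b → b ≤ h + a → ballots h (suc a) (suc b) ≡ ballots h a (suc b) + ballots h (suc a) b
ballots-last zero    zero    zero    p = refl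
ballots-last zero    (suc a) zero    p = trans (ballots-last 1 a 0 z≤n)
  (cong (ballots 1 a 1 +_) (trans (ballots-b0 1 (suc a)) (sym (ballots-b0 2 a))))
ballots-last zero    (suc a) (suc b) p = ballots-last 1 a (suc b) p
ballots-last (suc h) zero    zero    p = refl
ballots-last (suc h) zero    (suc b) (s≤s p) = begin
  ballots h 0 b + ballots h 1 (suc b)                     ≡⟨ cong₂ _+_ (ballots-a0 h b b≤h) (ballots-last h 0 b p) ⟩
  1 + (ballots h 0 (suc b) + ballots h 1 b)               ≡⟨ lem (ballots h 0 (suc b)) (ballots h 1 b) ⟩
  ballots h 0 (suc b) + (1 + ballots h 1 b)               ≡⟨ cong (λ x → ballots h 0 (suc b) + (x + ballots h 1 b)) (ballots-a0 (suc h) b (m≤n⇒m≤1+n b≤h)) ⟨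
  ballots h 0 (suc b) + (ballots (suc h) 0 b + ballots h 1 b)   ∎
  where
  open ≡-Reasoning
  b≤h : b ≤ h
  b≤h = subst (b ≤_) (+-identityʳ h) p
  lem : ∀ x y → 1 + (x + y) ≡ x + (1 + y)
  lem = solve-∀
ballots-last (suc h) (suc a) zero    p
  rewrite ballots-last (suc (suc h)) a 0 z≤n | ballots-b0 (suc (suc (suc h))) a | ballots-b0 (suc (suc h)) a
        | ballots-b0 (suc h) a = refl
ballots-last (suc h) (suc a) (suc b) (s≤s p) = trans
  (cong₂ _+_ (ballots-last (suc (suc h)) a (suc b) (s≤s (subst (b ≤_) (+-suc h a) p))) (ballots-last h (suc a) b p))
  (lem (ballots (suc (suc h)) a (suc (suc b))) _ _ _)
  where
  lem : ∀ x y z u → (x + y) + (z + u) ≡ (x + z) + (y + u)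
  lem = solve-∀

-- The row of the largest entry is the last letter of the ballot word, so `ballots-last` gives the
-- recursion of `syt`.
syt-ballots : ∀ b e → syt b e ≡ ballots 0 (b + e) b
syt-ballots zero    e       = sym (ballots-b0 0 e)
syt-ballots (suc b) zero    = begin
  syt b 1                             ≡⟨ syt-ballots b 1 ⟩
  ballots 0 (b + 1) b                       ≡⟨ cong (λ x → ballots 0 x b) (+-suc b 0) ⟩
  -- In a rectangular shape the largest entry is not in the first row: removing it there would leave
  -- more bottom than top entries.
  ballots 0 (suc (b + 0)) b                 ≡⟨ cong (_+ ballots 0 (suc (b + 0)) b) (ballots-vanish 0 (b + 0) (suc b) (s≤s (≤-reflexive (+-identityʳ b)))) ⟨
  ballots 0 (b + 0) (suc b) + ballots 0 (suc (b + 0)) b ≡⟨ ballots-last 0 (b + 0) b (m≤m+n b 0) ⟨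
  ballots 0 (suc (b + 0)) (suc b)           ∎
  where open ≡-Reasoning
syt-ballots (suc b) (suc e) = begin
  syt b (2 + e) + syt (suc b) e       ≡⟨ +-comm (syt b (2 + e)) _ ⟩
  syt (suc b) e + syt b (2 + e)       ≡⟨ cong₂ _+_ (syt-ballots (suc b) e) (syt-ballots b (2 + e)) ⟩
  ballots 0 (suc b + e) (suc b) + ballots 0 (b + (2 + e)) b
    ≡⟨ cong₂ (λ x y → ballots 0 x (suc b) + ballots 0 y b) (sym (+-suc b e)) (+-suc b (suc e)) ⟩
  ballots 0 (b + suc e) (suc b) + ballots 0 (suc (b + suc e)) b ≡⟨ ballots-last 0 (b + suc e) b (m≤m+n b (suc e)) ⟨
  ballots 0 (suc (b + suc e)) (suc b) ∎
  where open ≡-Reasoning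

trows : List TRow
trows = top ∷ bot ∷ []

positionsFrom-all> : ∀ {X : Set} (p : X → Bool) i w {j} → j < i → All (j <_) (positionsFrom p i w)
positionsFrom-all> p i []      lt = []
positionsFrom-all> p i (x ∷ w) lt with p x
... | true  = lt ∷ positionsFrom-all> p (suc i) w (m<n⇒m<1+n lt)
... | false = positionsFrom-all> p (suc i) w (m<n⇒m<1+n lt)

<ᵇ-true : ∀ {m n} → m < n → (m <ᵇ n) ≡ true
<ᵇ-true {m} {n} lt with m <ᵇ n | <⇒<ᵇ lt
... | true | _ = refl

<ᵇ-false : ∀ {m n} → n ≤ m → (m <ᵇ n) ≡ false
<ᵇ-false {m} {n} le with m <ᵇ n in eq
... | false = refl
... | true  = ⊥-elim (<-irrefl refl (≤-trans (<ᵇ⇒< m n (subst T (sym eq) _)) le))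

-- X lists the tops still waiting for a partner.
columns-ballot : ∀ i w X → All (_< i) X →
  columnsIncrease (X ++ positionsFrom isTop i w) (positionsFrom isBot i w) ≡ ballot (length X) w
columns-ballot i []        []       _ = refl
columns-ballot i []        (x ∷ X)  _ = refl
columns-ballot i (top ∷ w) X        h =
  trans (cong (λ Z → columnsIncrease Z _) (sym (++-assoc X (i ∷ []) _)))
  (trans (columns-ballot (suc i) w (X ++ i ∷ []) (++⁺ (All.map m<n⇒m<1+n h) (≤-refl ∷ [])))
    (cong (λ m → ballot m w) (trans (length-++ X) (+-comm (length X) 1))))
columns-ballot i (bot ∷ w) []       h with positionsFrom isTop (suc i) w | positionsFrom-all> isTop (suc i) w {i} ≤-refl
... | []    | _       = refl
... | x ∷ _ | lt ∷ _ rewrite <ᵇ-false (<⇒≤ lt) = refl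
columns-ballot i (bot ∷ w) (x ∷ X)  (lt ∷ h) rewrite <ᵇ-true lt =
  columns-ballot (suc i) w X (All.map m<n⇒m<1+n h)

tcontent : List TRow → ℕ → ℕ → Bool
tcontent []        a       b       = (0 ≡ᵇ a) ∧ (0 ≡ᵇ b)
tcontent (top ∷ w) zero    b       = false
tcontent (top ∷ w) (suc a) b       = tcontent w a b
tcontent (bot ∷ w) a       zero    = false
tcontent (bot ∷ w) a       (suc b) = tcontent w a b

tcontent-length : ∀ i w a b →
  (length (positionsFrom isTop i w) ≡ᵇ a) ∧ (length (positionsFrom isBot i w) ≡ᵇ b) ≡ tcontent w a b
tcontent-length i []        a       b       = refl
tcontent-length i (top ∷ w) zero    b       = refl
tcontent-length i (top ∷ w) (suc a) b       = tcontent-length (suc i) w a b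
tcontent-length i (bot ∷ w) a       zero    = ∧-zeroʳ _
tcontent-length i (bot ∷ w) a       (suc b) = tcontent-length (suc i) w a b

ballots-count : ∀ N h a b → N ≡ a + b → wsum trows (λ w → ⟦ tcontent w a b ∧ ballot h w ⟧) N ≡ ballots h a b
ballots-count zero    h       zero    zero    eq = refl
ballots-count (suc N) zero    zero    (suc b) eq = cong₂ _+_ (wsum-0 trows N) (trans (+-identityʳ _)
  (trans (wsum-cong trows (λ w → cong ⟦_⟧ (∧-zeroʳ (tcontent w 0 b))) N) (wsum-0 trows N)))
ballots-count (suc N) (suc h) zero    (suc b) eq = cong₂ _+_ (wsum-0 trows N) (trans (+-identityʳ _)
  (ballots-count N h zero b (suc-injective eq)))
ballots-count (suc N) h       (suc a) zero    eq = trans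
  (cong₂ _+_ (ballots-count N (suc h) a zero (suc-injective eq)) (trans (+-identityʳ _) (wsum-0 trows N)))
  (+-identityʳ _)
ballots-count (suc N) zero    (suc a) (suc b) eq = trans
  (cong₂ _+_ (ballots-count N 1 a (suc b) (suc-injective eq)) (trans (+-identityʳ _)
    (trans (wsum-cong trows (λ w → cong ⟦_⟧ (∧-zeroʳ (tcontent w (suc a) b))) N) (wsum-0 trows N))))
  (+-identityʳ _)
ballots-count (suc N) (suc h) (suc a) (suc b) eq = cong₂ _+_
  (ballots-count N (suc (suc h)) a (suc b) (suc-injective eq))
  (trans (+-identityʳ _) (ballots-count N h (suc a) b (trans (suc-injective eq) (+-suc a b))))

f-syt : ∀ b e → f (b + e) b ≡ syt b e
f-syt b e = begin
  f (b + e) b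
    ≡⟨ count-allWords trows (isSYT (b + e) b) (b + e + b) ⟩
  wsum trows (λ w → ⟦ isSYT (b + e) b w ⟧) (b + e + b)
    ≡⟨ wsum-cong trows (λ w → cong ⟦_⟧ (isSYT-ballot w)) (b + e + b) ⟩
  wsum trows (λ w → ⟦ tcontent w (b + e) b ∧ ballot 0 w ⟧) (b + e + b)
    ≡⟨ ballots-count (b + e + b) 0 (b + e) b refl ⟩
  ballots 0 (b + e) b
    ≡⟨ syt-ballots b e ⟨
  syt b e ∎
  where
  open ≡-Reasoning
  isSYT-ballot : ∀ w → isSYT (b + e) b w ≡ tcontent w (b + e) b ∧ ballot 0 w
  isSYT-ballot w = trans (sym (∧-assoc (length (positions isTop w) ≡ᵇ b + e) _ _))
    (cong₂ _∧_ (tcontent-length 1 w (b + e) b) (columns-ballot 1 w [] []))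

content-length : ∀ i w a b c →
  (length (positionsFrom is1 i w) ≡ᵇ a) ∧ (length (positionsFrom is2 i w) ≡ᵇ b)
    ∧ (length (positionsFrom is3 i w) ≡ᵇ c) ≡ content w a b c
content-length i []       a       b       c       = refl
content-length i (r1 ∷ w) zero    b       c       = refl
content-length i (r1 ∷ w) (suc a) b       c       = content-length (suc i) w a b c
content-length i (r2 ∷ w) a       zero    c       = ∧-zeroʳ _
content-length i (r2 ∷ w) a       (suc b) c       = content-length (suc i) w a b c
content-length i (r3 ∷ w) a       b       zero    =
  trans (cong ((length (positionsFrom is1 (suc i) w) ≡ᵇ a) ∧_) (∧-zeroʳ _)) (∧-zeroʳ _)
content-length i (r3 ∷ w) a       b       (suc c) = content-length (suc i) w a b c

-- Bullying on sorted lists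

Sorted : List ℕ → Set
Sorted = AllPairs _<_

hasGt : ℕ → List ℕ → Bool
hasGt x []       = false
hasGt x (y ∷ ys) = if x <ᵇ y then true else hasGt x ys

removeGt : ℕ → List ℕ → List ℕ
removeGt x []       = []
removeGt x (y ∷ ys) = if x <ᵇ y then ys else y ∷ removeGt x ys

data Delete (z : ℕ) : List ℕ → List ℕ → Set where
  here  : ∀ {L} → Delete z (z ∷ L) L
  there : ∀ {l L L′} → Delete z L L′ → Delete z (l ∷ L) (l ∷ L′)

Delete-All : ∀ {z L L′} {P : ℕ → Set} → Delete z L L′ → All P L → All P L′
Delete-All here      (_ ∷ ps) = ps
Delete-All (there δ) (p ∷ ps) = p ∷ Delete-All δ ps

Delete-Sorted : ∀ {z L L′} → Delete z L L′ → Sorted L → Sorted L′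
Delete-Sorted here      (_ ∷ s)  = s
Delete-Sorted (there δ) (h ∷ s)  = Delete-All δ h ∷ Delete-Sorted δ s

Delete-∈ : ∀ {z L L′} {P : ℕ → Set} → Delete z L L′ → All P L → P z
Delete-∈ here      (p ∷ _)  = p
Delete-∈ (there δ) (_ ∷ ps) = Delete-∈ δ ps

Delete-length : ∀ {z L L′} → Delete z L L′ → length L ≡ suc (length L′)
Delete-length here      = refl
Delete-length (there δ) = cong suc (Delete-length δ)

≡ᵇ-refl : ∀ n → (n ≡ᵇ n) ≡ true
≡ᵇ-refl zero    = refl
≡ᵇ-refl (suc n) = ≡ᵇ-refl n

≡ᵇ-false : ∀ {m n} → m ≢ n → (m ≡ᵇ n) ≡ false
≡ᵇ-false {m} {n} m≢n with m ≡ᵇ n in eq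
... | false = refl
... | true  = ⊥-elim (m≢n (≡ᵇ⇒≡ m n (subst T (sym eq) _)))

remove-absent : ∀ {z} L → All (z <_) L → remove z L ≡ L
remove-absent []      []       = refl
remove-absent (l ∷ L) (p ∷ ps) rewrite ≡ᵇ-false (λ l≡z → <-irrefl (sym l≡z) p) = cong (l ∷_) (remove-absent L ps)

-- `remove` filters out every copy of z, but a strictly increasing list has only one.
Delete-remove : ∀ {z L L′} → Sorted L → Delete z L L′ → remove z L ≡ L′
Delete-remove {z} (h ∷ s) (here {L}) rewrite ≡ᵇ-refl z = remove-absent L h
Delete-remove (h ∷ s) (there {l} δ) rewrite ≡ᵇ-false (λ l≡z → <-irrefl l≡z (Delete-∈ δ h)) =
  cong (l ∷_) (Delete-remove s δ)

firstGt-view : ∀ x L → hasGt x L ≡ true → ∃ λ z → firstGt x L ≡ just z × x < z × Delete z L (removeGt x L)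
firstGt-view x (y ∷ ys) h with x <ᵇ y in eq
... | true  = y , refl , <ᵇ⇒< x y (subst T (sym eq) _) , here
... | false = let z , f , lt , δ = firstGt-view x ys h in z , f , lt , there δ

firstGt-none : ∀ x L → hasGt x L ≡ false → firstGt x L ≡ nothing
firstGt-none x []       h = refl
firstGt-none x (y ∷ ys) h with x <ᵇ y
... | false = firstGt-none x ys h

data Pick (x l : ℕ) (L : List ℕ) : Set where
  larger : ∀ z → hasGt x (l ∷ L) ≡ true → pick x (l ∷ L) ≡ just (z , false) → x < z →
           Delete z (l ∷ L) (removeGt x (l ∷ L)) → Pick x l L
  wraps  : hasGt x (l ∷ L) ≡ false → pick x (l ∷ L) ≡ just (l , true) → Pick x l L

pick-view : ∀ x l L → Pick x l L
pick-view x l L with hasGt x (l ∷ L) in eq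
... | true  = let z , f , lt , δ = firstGt-view x (l ∷ L) eq in larger z eq (eq′ f) lt δ
  where
  eq′ : ∀ {z} → firstGt x (l ∷ L) ≡ just z → pick x (l ∷ L) ≡ just (z , false)
  eq′ f rewrite f = refl
... | false = wraps eq eq′
  where
  eq′ : pick x (l ∷ L) ≡ just (l , true)
  eq′ rewrite firstGt-none x (l ∷ L) eq = refl

-- Linear matching and its independence of the order

-- One bullying without wrap-around: an entry that finds nothing larger is only counted, and it
-- consumes nothing.
stepO : List ℕ × ℕ → ℕ → List ℕ × ℕ
stepO (D , o) y = if hasGt y D then (removeGt y D , o) else (D , suc o)

consP : ℕ → List ℕ × ℕ → List ℕ × ℕ
consP d (D , o) = d ∷ D , o

stepO-head : ∀ {y d} D o → y < d → stepO (d ∷ D , o) y ≡ (D , o)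
stepO-head D o lt rewrite <ᵇ-true lt = refl

stepO-cons : ∀ {y d} s → d ≤ y → stepO (consP d s) y ≡ consP d (stepO s y)
stepO-cons {y} (D , o) le rewrite <ᵇ-false le with hasGt y D
... | true  = refl
... | false = refl

removeGt-All : ∀ {P : ℕ → Set} y D → All P D → All P (removeGt y D)
removeGt-All y []      []       = []
removeGt-All y (d ∷ D) (p ∷ ps) with y <ᵇ d
... | true  = ps
... | false = p ∷ removeGt-All y D ps

removeGt-Sorted : ∀ y D → Sorted D → Sorted (removeGt y D)
removeGt-Sorted y []      []      = []
removeGt-Sorted y (d ∷ D) (h ∷ s) with y <ᵇ d
... | true  = s
... | false = removeGt-All y D h ∷ removeGt-Sorted y D s

stepO-All : ∀ {P : ℕ → Set} s y → All P (proj₁ s) → All P (proj₁ (stepO s y))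
stepO-All (D , o) y ps with hasGt y D
... | true  = removeGt-All y D ps
... | false = ps

stepO-Sorted : ∀ s y → Sorted (proj₁ s) → Sorted (proj₁ (stepO s y))
stepO-Sorted (D , o) y ps with hasGt y D
... | true  = removeGt-Sorted y D ps
... | false = ps

stepO-below : ∀ {x y d} D o → All (d <_) D → x < d → y < d → stepO (D , o) x ≡ stepO (D , o) y
stepO-below []      o _        _  _  = refl
stepO-below (e ∷ D) o (lt ∷ _) xd yd =
  trans (stepO-head D o (<-trans xd lt)) (sym (stepO-head D o (<-trans yd lt)))

-- If both entries lie below the head, each of them would take the head and then the next element,
-- so they are interchangeable; if one does, it takes the head and the other acts on the tail; if
-- neither does, the head is irrelevant.
stepO-comm : ∀ D o x y → Sorted D → stepO (stepO (D , o) x) y ≡ stepO (stepO (D , o) y) x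
stepO-comm []      o x y s = refl
stepO-comm (d ∷ D) o x y (h ∷ s) with x <? d | y <? d
... | yes xd | yes yd
  rewrite stepO-head D o xd | stepO-head D o yd = sym (stepO-below D o h xd yd)
... | yes xd | no  yd
  rewrite stepO-head D o xd | stepO-cons {y} (D , o) (≮⇒≥ yd) = sym (stepO-head _ _ xd)
... | no  xd | yes yd
  rewrite stepO-head D o yd | stepO-cons {x} (D , o) (≮⇒≥ xd) = stepO-head _ _ yd
... | no  xd | no  yd
  rewrite stepO-cons {x} (D , o) (≮⇒≥ xd) | stepO-cons {y} (D , o) (≮⇒≥ yd)
        | stepO-cons {y} (stepO (D , o) x) (≮⇒≥ yd) | stepO-cons {x} (stepO (D , o) y) (≮⇒≥ xd) =
  cong (consP d) (stepO-comm D o x y s)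

foldl-stepO-↭ : ∀ {xs ys} s → Sorted (proj₁ s) → xs ↭ ys → foldl stepO s xs ≡ foldl stepO s ys
foldl-stepO-↭ s h refl          = refl
foldl-stepO-↭ s h (prep x p)    = foldl-stepO-↭ (stepO s x) (stepO-Sorted s x h) p
foldl-stepO-↭ s h (swap {xs} x y p)  = trans
  (cong (λ t → foldl stepO t xs) (stepO-comm (proj₁ s) (proj₂ s) x y h))
  (foldl-stepO-↭ (stepO (stepO s y) x) (stepO-Sorted (stepO s y) x (stepO-Sorted s y h)) p)
foldl-stepO-↭ s h (↭.trans p q) = trans (foldl-stepO-↭ s h p) (foldl-stepO-↭ s h q)

-- Processing from right to left, which order independence permits and which fits the recursions of
-- `avail` and `overflow`.
procR : List ℕ → List ℕ → List ℕ × ℕ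
procR D = foldr (λ y s → stepO s y) (D , 0)

foldl≡procR : ∀ {D ys ys′} → Sorted D → ys ↭ ys′ → foldl stepO (D , 0) ys ≡ procR D ys′
foldl≡procR {D} {ys} {ys′} h p = trans
  (foldl-stepO-↭ (D , 0) h (↭-trans p (↭-sym (↭-reverse ys′))))
  (reverse-foldl stepO (D , 0) ys′)

procR-cons : ∀ {d} D L → All (d ≤_) L → procR (d ∷ D) L ≡ consP d (procR D L)
procR-cons D []      []       = refl
procR-cons D (y ∷ L) (p ∷ ps) rewrite procR-cons D L ps = stepO-cons (procR D L) p

procR-All : ∀ {P : ℕ → Set} D L → All P D → All P (proj₁ (procR D L))
procR-All D []      h = h
procR-All D (y ∷ L) h = stepO-All (procR D L) y (procR-All D L h)

Interleaving-All : ∀ {P : ℕ → Set} {ys zs L : List ℕ} → Interleaving ys zs L → All P L → All P ys × All P zs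
Interleaving-All []         []       = [] , []
Interleaving-All (consˡ sp) (p ∷ ps) = let a , b = Interleaving-All sp ps in p ∷ a , b
Interleaving-All (consʳ sp) (p ∷ ps) = let a , b = Interleaving-All sp ps in a , p ∷ b

Interleaving-[] : {ys L : List ℕ} → Interleaving ys [] L → ys ≡ L
Interleaving-[] []         = refl
Interleaving-[] (consˡ sp) = cong (_ ∷_) (Interleaving-[] sp)

-- Matching 2s with 3s, read off the word

pos1 pos2 pos3 : ℕ → List Row → List ℕ
pos1 = positionsFrom is1
pos2 = positionsFrom is2
pos3 = positionsFrom is3

-- All 3s still available lie to the right of the 2 being processed, so only their number matters.
procR-full : ∀ i w → length (proj₁ (procR (pos3 i w) (pos2 i w))) ≡ avail w
                   × proj₂ (procR (pos3 i w) (pos2 i w)) ≡ overflow w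
procR-full i []       = refl , refl
procR-full i (r1 ∷ w) = procR-full (suc i) w
procR-full i (r2 ∷ w) with procR (pos3 (suc i) w) (pos2 (suc i) w) | procR-full (suc i) w
    | procR-All (pos3 (suc i) w) (pos2 (suc i) w) (positionsFrom-all> is3 (suc i) w {i} ≤-refl)
... | [] , o    | p , q | _ rewrite sym p = refl , cong suc q
... | d ∷ D , o | p , q | lt ∷ _ rewrite sym p | stepO-head D o lt = refl , q
procR-full i (r3 ∷ w)
  rewrite procR-cons {i} (pos3 (suc i) w) (pos2 (suc i) w)
            (All.map <⇒≤ (positionsFrom-all> is2 (suc i) w ≤-refl)) =
  let p , q = procR-full (suc i) w in cong suc p , q

-- Position of the leftmost letter of the shortest suffix with one more 2 than 3s.
critPos : ℕ → List Row → ℕ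
critPos i []      = i
critPos i (_ ∷ w) = if overflow w ≡ᵇ 1 then critPos (suc i) w else i

i≤critPos : ∀ i w → i ≤ critPos i w
i≤critPos i []      = ≤-refl
i≤critPos i (_ ∷ w) with overflow w ≡ᵇ 1
... | true  = <⇒≤ (i≤critPos (suc i) w)
... | false = ≤-refl

nonempty : List ℕ → ℕ
nonempty []      = 0
nonempty (_ ∷ _) = 1

before : ℕ → List ℕ → Bool
before q []       = true
before q (z ∷ zs) = (z <ᵇ q) ∧ before q zs

procR-none : ∀ i w {ys zs} → Interleaving ys zs (pos2 i w) → zs ≡ [] →
  length (proj₁ (procR (pos3 i w) ys)) ≡ avail w × proj₂ (procR (pos3 i w) ys) ≡ overflow w
procR-none i w sp refl rewrite Interleaving-[] sp = procR-full i w

-- Dropping some of the 2s (zs) saves the single overflow iff one of them lies in the critical suffix.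
procR-sub : ∀ i w {ys zs} → Interleaving ys zs (pos2 i w) →
  (overflow w ≡ 0 → proj₂ (procR (pos3 i w) ys) ≡ 0
            × avail w + nonempty zs ≤ length (proj₁ (procR (pos3 i w) ys)))
  × (overflow w ≡ 1 → proj₂ (procR (pos3 i w) ys) ≡ ⟦ before (critPos i w) zs ⟧
              × avail w ≤ length (proj₁ (procR (pos3 i w) ys)))
procR-sub i [] [] = (λ _ → refl , z≤n) , λ ()
procR-sub i (r1 ∷ w) sp with overflow w | procR-sub (suc i) w sp
... | zero        | p , q = p , λ ()
... | suc zero    | p , q = (λ ()) , q
... | suc (suc _) | p , q = (λ ()) , λ ()
procR-sub i (r3 ∷ w) {ys} sp
  rewrite procR-cons {i} (pos3 (suc i) w) ys
            (All.map <⇒≤ (proj₁ (Interleaving-All sp (positionsFrom-all> is2 (suc i) w ≤-refl))))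
  with overflow w | procR-sub (suc i) w sp
... | zero        | p , q = (λ h → proj₁ (p h) , s≤s (proj₂ (p h))) , λ ()
... | suc zero    | p , q = (λ ()) , λ h → proj₁ (q h) , s≤s (proj₂ (q h))
... | suc (suc _) | p , q = (λ ()) , λ ()
procR-sub i (r2 ∷ w) {_ ∷ ys} {zs} (consˡ sp)
  with procR (pos3 (suc i) w) ys | overflow w | avail w | procR-sub (suc i) w sp | procR-none (suc i) w sp
     | procR-All (pos3 (suc i) w) ys (positionsFrom-all> is3 (suc i) w {i} ≤-refl)
     | proj₂ (Interleaving-All sp (positionsFrom-all> is2 (suc i) w {i} ≤-refl))
procR-sub i (r2 ∷ w) {_ ∷ ys} {[]} (consˡ sp) | [] , o | zero | zero | p , q | n | _ | _ =
  (λ ()) , λ _ → cong suc (proj₂ (n refl)) , z≤n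
procR-sub i (r2 ∷ w) {_ ∷ ys} {[]} (consˡ sp) | d ∷ D , o | zero | zero | p , q | n | _ | _
  with proj₁ (n refl)
... | ()
-- A 2 dropped further right leaves a spare 3, as the term `nonempty` records, so the list cannot be
-- empty. In the next clause that spare 3 serves the critical 2.
procR-sub i (r2 ∷ w) {_ ∷ ys} {z ∷ zs} (consˡ sp) | [] , o | zero | zero | p , q | n | _ | _
  with proj₂ (p refl)
... | ()
procR-sub i (r2 ∷ w) {_ ∷ ys} {z ∷ zs} (consˡ sp) | d ∷ D , o | zero | zero | p , q | n | lt ∷ _ | zlt ∷ _
  rewrite stepO-head D o lt | <ᵇ-false (<⇒≤ zlt) = (λ ()) , λ _ → proj₁ (p refl) , z≤n
procR-sub i (r2 ∷ w) {_ ∷ ys} {zs} (consˡ sp) | [] , o | zero | suc v | p , q | n | _ | _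
  with proj₂ (p refl)
... | ()
procR-sub i (r2 ∷ w) {_ ∷ ys} {zs} (consˡ sp) | d ∷ D , o | zero | suc v | p , q | n | lt ∷ _ | _
  rewrite stepO-head D o lt = (λ _ → proj₁ (p refl) , ≤-pred (proj₂ (p refl))) , λ ()
procR-sub i (r2 ∷ w) {_ ∷ ys} {zs} (consˡ sp) | _ | suc zero | zero | p , q | n | _ | _ = (λ ()) , λ ()
procR-sub i (r2 ∷ w) {_ ∷ ys} {zs} (consˡ sp) | [] , o | suc zero | suc v | p , q | n | _ | _
  with proj₂ (q refl)
... | ()
procR-sub i (r2 ∷ w) {_ ∷ ys} {zs} (consˡ sp) | d ∷ D , o | suc zero | suc v | p , q | n | lt ∷ _ | _
  rewrite stepO-head D o lt = (λ ()) , λ _ → proj₁ (q refl) , ≤-pred (proj₂ (q refl))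
procR-sub i (r2 ∷ w) {_ ∷ ys} {zs} (consˡ sp) | _ | suc (suc o) | zero | p , q | n | _ | _ = (λ ()) , λ ()
procR-sub i (r2 ∷ w) {_ ∷ ys} {zs} (consˡ sp) | _ | suc (suc o) | suc v | p , q | n | _ | _ = (λ ()) , λ ()
procR-sub i (r2 ∷ w) {ys} {_ ∷ zs} (consʳ sp)
  with overflow w | avail w | procR-sub (suc i) w sp
-- The dropped 2 stands at the critical position itself and was the overflow; `before` is strict, so
-- it does not count as lying before the suffix.
... | zero | zero | p , q rewrite <ᵇ-false (≤-refl {i}) = (λ ()) , λ _ → proj₁ (p refl) , z≤n
... | zero | suc v | p , q =
  (λ _ → proj₁ (p refl) , ≤-trans (≤-reflexive (+-comm v 1)) (≤-trans (m≤m+n (suc v) _) (proj₂ (p refl)))) , λ ()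
... | suc zero | zero | p , q = (λ ()) , λ ()
... | suc zero | suc v | p , q rewrite <ᵇ-true (i≤critPos (suc i) w) =
  (λ ()) , λ _ → proj₁ (q refl) , <⇒≤ (proj₂ (q refl))
... | suc (suc o) | zero | p , q = (λ ()) , λ ()
... | suc (suc o) | suc v | p , q = (λ ()) , λ ()

-- Matching 1s with 2s

-- Positions of the 2s that are not reached by a 1 on their left, k further 1s being pending.
unmatched : ℕ → ℕ → List Row → List ℕ
unmatched k       i []       = []
unmatched k       i (r1 ∷ w) = unmatched (suc k) (suc i) w
unmatched zero    i (r2 ∷ w) = i ∷ unmatched zero (suc i) w
unmatched (suc k) i (r2 ∷ w) = unmatched k (suc i) w
unmatched k       i (r3 ∷ w) = unmatched k (suc i) w

before-unmatched : ∀ {j} k i w → j ≤ i → before j (unmatched k i w) ≡ allMatched k w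
before-unmatched k       i []       le = refl
before-unmatched k       i (r1 ∷ w) le = before-unmatched (suc k) (suc i) w (m≤n⇒m≤1+n le)
before-unmatched zero    i (r2 ∷ w) le rewrite <ᵇ-false le = refl
before-unmatched (suc k) i (r2 ∷ w) le = before-unmatched k (suc i) w (m≤n⇒m≤1+n le)
before-unmatched k       i (r3 ∷ w) le = before-unmatched k (suc i) w (m≤n⇒m≤1+n le)

-- Unmatched 2s in front of the critical suffix are harmless; at its first letter `critMatched`
-- turns into `allMatched`.
before-critPos : ∀ k i w → overflow w ≡ 1 → before (critPos i w) (unmatched k i w) ≡ critMatched k w
before-critPos k i (r1 ∷ w) h rewrite h = before-critPos (suc k) (suc i) w h
before-critPos k i (r3 ∷ w) h rewrite h = before-critPos k (suc i) w h
before-critPos k i (r2 ∷ w) h with overflow w in eq | avail w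
before-critPos zero    i (r2 ∷ w) h | zero | zero rewrite <ᵇ-false (≤-refl {i}) = refl
before-critPos (suc k) i (r2 ∷ w) h | zero | zero = before-unmatched k (suc i) w (n≤1+n i)
before-critPos zero    i (r2 ∷ w) h | suc zero | suc v rewrite <ᵇ-true (i≤critPos (suc i) w) = before-critPos 0 (suc i) w eq
before-critPos (suc k) i (r2 ∷ w) h | suc zero | suc v = before-critPos k (suc i) w eq

foldl-consP : ∀ {d} s X → All (d ≤_) X → foldl stepO (consP d s) X ≡ consP d (foldl stepO s X)
foldl-consP s []      []       = refl
foldl-consP s (x ∷ X) (p ∷ ps) rewrite stepO-cons s p = foldl-consP (stepO s x) X ps

foldl-[] : ∀ o X → proj₁ (foldl stepO ([] , o) X) ≡ []
foldl-[] o []      = refl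
foldl-[] o (x ∷ X) = foldl-[] (suc o) X

-- `X` is the queue of 1s already read and not yet used; the next 2 goes to the first of them.
foldl-unmatched : ∀ i w X → All (_< i) X →
  proj₁ (foldl stepO (pos2 i w , 0) (X ++ pos1 i w)) ≡ unmatched (length X) i w
foldl-unmatched i []       X h = foldl-[] 0 (X ++ [])
foldl-unmatched i (r1 ∷ w) X h =
  trans (cong (λ Z → proj₁ (foldl stepO (pos2 (suc i) w , 0) Z)) (sym (++-assoc X (i ∷ []) _)))
  (trans (foldl-unmatched (suc i) w (X ++ i ∷ []) (++⁺ (All.map m<n⇒m<1+n h) (≤-refl ∷ [])))
    (cong (λ m → unmatched m (suc i) w) (trans (length-++ X) (+-comm (length X) 1))))
foldl-unmatched i (r2 ∷ w) [] h
  rewrite foldl-consP {i} (pos2 (suc i) w , 0) (pos1 (suc i) w)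
            (All.map <⇒≤ (positionsFrom-all> is1 (suc i) w ≤-refl)) =
  cong (i ∷_) (foldl-unmatched (suc i) w [] [])
foldl-unmatched i (r2 ∷ w) (x ∷ X) (lt ∷ h)
  rewrite stepO-head (pos2 (suc i) w) 0 lt = foldl-unmatched (suc i) w X (All.map m<n⇒m<1+n h)
foldl-unmatched i (r3 ∷ w) X h = foldl-unmatched (suc i) w X (All.map m<n⇒m<1+n h)

foldl-Sorted : ∀ s X → Sorted (proj₁ s) → Sorted (proj₁ (foldl stepO s X))
foldl-Sorted s []      h = h
foldl-Sorted s (x ∷ X) h = foldl-Sorted (stepO s x) X (stepO-Sorted s x h)

-- Row 1 against row 2, with wrappings

-- The entries X of row 1, one after the other, bully ys in row 2 (available: L) and leave zs.
data Phase1 : List ℕ → List ℕ → List ℕ → List ℕ → Set where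
  done : ∀ {L} → Phase1 [] L [] L
  next : ∀ {x y b X L ys zs} → pick x L ≡ just (y , b) → Delete y L (remove y L) →
         Phase1 X (remove y L) ys zs → Phase1 (x ∷ X) L (y ∷ ys) zs

phase1-exists : ∀ X L → Sorted L → length X ≤ length L → ∃₂ λ ys zs → Phase1 X L ys zs
phase1-exists []      L       s le = [] , L , done
phase1-exists (x ∷ X) (l ∷ L) s le = first (pick-view x l L)
  where
  continue : ∀ {y b L′} → pick x (l ∷ L) ≡ just (y , b) → Delete y (l ∷ L) L′ →
    ∃₂ λ ys zs → Phase1 (x ∷ X) (l ∷ L) ys zs
  continue {y} {L′ = L′} pk δ =
    let ys , zs , ph = phase1-exists X L′ (Delete-Sorted δ s) (≤-pred (≤-trans le (≤-reflexive (Delete-length δ))))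
        eq = sym (Delete-remove s δ)
    in y ∷ ys , zs , next pk (subst (Delete y (l ∷ L)) eq δ) (subst (λ L′ → Phase1 X L′ ys zs) eq ph)
  first : Pick x l L → ∃₂ λ ys zs → Phase1 (x ∷ X) (l ∷ L) ys zs
  first (larger z _ pk _ δ) = continue pk δ
  first (wraps _ pk)        = continue pk here

phase1-length : ∀ {X L ys zs} → Phase1 X L ys zs → length L ≡ length X + length zs
phase1-length done          = refl
phase1-length (next _ δ ph) = trans (Delete-length δ) (cong suc (phase1-length ph))

Interleaving-undelete : ∀ {y L L′} {ys zs : List ℕ} → Delete y L L′ → Interleaving ys zs L′ →
  ∃ λ ys′ → Interleaving ys′ zs L × y ∷ ys ↭ ys′
Interleaving-undelete here      sp         = _ , consˡ sp , ↭-refl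
Interleaving-undelete (there δ) (consˡ sp) =
  let ys′ , sp′ , p = Interleaving-undelete δ sp in _ , consˡ sp′ , ↭.trans (swap _ _ ↭-refl) (prep _ p)
Interleaving-undelete (there δ) (consʳ sp) =
  let ys′ , sp′ , p = Interleaving-undelete δ sp in ys′ , consʳ sp′ , p

Interleaving-right : ∀ (L : List ℕ) → Interleaving [] L L
Interleaving-right []      = []
Interleaving-right (x ∷ L) = consʳ (Interleaving-right L)

phase1-interleaving : ∀ {X L ys zs} → Phase1 X L ys zs → ∃ λ ys′ → Interleaving ys′ zs L × ys ↭ ys′
phase1-interleaving (done {L})    = [] , Interleaving-right L , ↭-refl
phase1-interleaving (next _ δ ph) =
  let ys₁ , sp₁ , p₁ = phase1-interleaving ph
      ys₂ , sp₂ , p₂ = Interleaving-undelete δ sp₁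
  in ys₂ , sp₂ , ↭.trans (prep _ p₁) p₂

hasGt-mono : ∀ {x x′} L → x ≤ x′ → hasGt x L ≡ false → hasGt x′ L ≡ false
hasGt-mono         []      le h = refl
hasGt-mono {x} {x′} (l ∷ L) le h with x <ᵇ l in eq
... | false rewrite <ᵇ-false {x′} {l} (≤-trans (≮⇒≥ λ lt → subst T eq (<⇒<ᵇ lt)) le) = hasGt-mono L le h

hasGt-tail : ∀ {x l} L → hasGt x (l ∷ L) ≡ false → hasGt x L ≡ false
hasGt-tail {x} {l} L h with x <ᵇ l
... | false = h

foldl-overflow : ∀ {x} X L o → hasGt x L ≡ false → All (x ≤_) X → foldl stepO (L , o) X ≡ (L , length X + o)
foldl-overflow []       L o h []       = refl
foldl-overflow {x} (x′ ∷ X) L o h (p ∷ ps) rewrite hasGt-mono L p h =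
  trans (foldl-overflow X L (suc o) h ps) (cong (L ,_) (+-suc (length X) o))

pick-overflow : ∀ {x y b} l L → hasGt x (l ∷ L) ≡ false → pick x (l ∷ L) ≡ just (y , b) → y ≡ l
pick-overflow {x} l L h eq with pick-view x l L
... | larger _ h′ _ _ _ with trans (sym h) h′
...   | ()
pick-overflow {x} l L h eq | wraps _ pk with trans (sym eq) pk
... | refl = refl

phase1-overflow : ∀ {x X L ys zs} → Sorted L → hasGt x L ≡ false → All (x ≤_) X → Phase1 X L ys zs →
  zs ≡ drop (length X) L
phase1-overflow s h ps done = refl
phase1-overflow {L = l ∷ L} s h (p ∷ ps) (next eq δ ph) with pick-overflow l L (hasGt-mono (l ∷ L) p h) eq
... | refl rewrite Delete-remove s (here {l} {L}) = phase1-overflow (AllPairs.tail s) (hasGt-tail {_} {l} L h) ps ph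

-- Once an entry of row 1 finds nothing larger, neither do the later, larger ones, and each of them
-- takes the smallest available entry. The cyclic procedure therefore leaves the result of the
-- linear one with an initial segment removed.
phase1-drop : ∀ {X L ys zs} o → Sorted X → Sorted L → Phase1 X L ys zs →
  ∃ λ n → zs ≡ drop n (proj₁ (foldl stepO (L , o) X))
phase1-drop o hX s done = 0 , refl
phase1-drop {x ∷ X} {l ∷ L} o (hx ∷ hX) s (next eq δ ph) with pick-view x l L
... | larger z h pk _ δ′ rewrite h with trans (sym pk) eq
...   | refl rewrite Delete-remove s δ′ = phase1-drop o hX (Delete-Sorted δ′ s) ph
phase1-drop {x ∷ X} {l ∷ L} o (hx ∷ hX) s (next eq δ ph) | wraps h pk with trans (sym pk) eq
... | refl rewrite h | Delete-remove s (here {l} {L}) | foldl-overflow X (l ∷ L) (suc o) h (All.map <⇒≤ hx) =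
  -- The wrapping entry itself and all of `X` after it.
  suc (length X) , phase1-overflow (AllPairs.tail s) (hasGt-tail {_} {l} L h) (All.map <⇒≤ hx) ph

-- For a sorted list only the largest entry matters, and it survives as long as something does.
before-drop : ∀ q n D → Sorted D → 0 < length (drop n D) → before q (drop n D) ≡ before q D
before-drop q zero    D           s       lt = refl
before-drop q (suc n) (d ∷ [])    s       lt with n | lt
... | zero  | ()
... | suc _ | ()
before-drop q (suc n) (d ∷ e ∷ D) ((d<e ∷ _) ∷ s) lt = trans (before-drop q n (e ∷ D) s lt) absorb
  where
  absorb : before q (e ∷ D) ≡ (d <ᵇ q) ∧ before q (e ∷ D)
  absorb with e <ᵇ q in eq
  ... | false = sym (∧-zeroʳ (d <ᵇ q))
  ... | true rewrite <ᵇ-true (<-trans d<e (<ᵇ⇒< e q (subst T (sym eq) _))) = refl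

-- Row 3 and the projected word

hasGt-skip : ∀ {y l} L → l ≤ y → hasGt y (l ∷ L) ≡ hasGt y L
hasGt-skip L le rewrite <ᵇ-false le = refl

removeGt-skip : ∀ {y l} L → l ≤ y → removeGt y (l ∷ L) ≡ l ∷ removeGt y L
removeGt-skip L le rewrite <ᵇ-false le = refl

pick-head : ∀ {y l} L → y < l → pick y (l ∷ L) ≡ just (l , false)
pick-head L lt rewrite <ᵇ-true lt = refl

pick-second : ∀ {y k l} L → k ≤ y → y < l → pick y (k ∷ l ∷ L) ≡ just (l , false)
pick-second L le lt rewrite <ᵇ-false le | <ᵇ-true lt = refl

step23-pick : ∀ {y z b a3} ℓ {a2 lb w} → pick y a3 ≡ just (z , b) →
  step23 ℓ y (st a2 a3 lb w) ≡ just (st a2 (remove z a3) ((z , ℓ) ∷ lb) (if b then suc w else w))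
step23-pick ℓ pk rewrite pk = refl

outcome : List ℕ → Maybe St → Bool
outcome cs nothing  = false
outcome cs (just σ) = (w23 σ ≡ᵇ 1) ∧ startsWith13 (projWord σ cs)

-- What is left of the state of the procedure on row 3, whose first two entries are c₁ < c₂:
-- free D / once ℓ D mean that c₁, c₂ / c₂ and D are available, once ℓ that c₁ was taken by the only wrapping,
-- with label ℓ; dead states cannot lead to exactly one wrapping and a projected word starting with 1 3.
data Status : Set where
  free : List ℕ → Status
  once : ℕ → List ℕ → Status
  dead : Status

module Row3 (c₁ c₂ : ℕ) (c₁<c₂ : c₁ < c₂) where

  bullies : ℕ → Status → ℕ → Status
  bullies ℓ (free D)   y = if y <ᵇ c₂ then dead else (if hasGt y D then free (removeGt y D) else once ℓ D)
  bullies ℓ (once m D) y = if y <ᵇ c₂ then dead else (if hasGt y D then once m (removeGt y D) else dead)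
  bullies ℓ dead       y = dead

  bullies-low : ∀ ℓ κ {y} → y < c₂ → bullies ℓ κ y ≡ dead
  bullies-low ℓ (free D)   lt rewrite <ᵇ-true lt = refl
  bullies-low ℓ (once m D) lt rewrite <ᵇ-true lt = refl
  bullies-low ℓ dead       lt = refl

  bullies-free : ∀ ℓ D {y} → c₂ ≤ y → bullies ℓ (free D) y ≡ (if hasGt y D then free (removeGt y D) else once ℓ D)
  bullies-free ℓ D le rewrite <ᵇ-false le = refl

  bullies-once : ∀ ℓ m D {y} → c₂ ≤ y → bullies ℓ (once m D) y ≡ (if hasGt y D then once m (removeGt y D) else dead)
  bullies-once ℓ m D le rewrite <ᵇ-false le = refl

  infix 4 _~_
  -- Label 3 is the default of `labelIn`, so it marks an entry not yet bullied. In `label~` the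
  -- second letter of the projected word is spoiled; in `still~` the entry c₁ was taken without a
  -- wrapping, so the first wrapping would land on c₂.
  data _~_ : Maybe St → Status → Set where
    free~  : ∀ {a2 D lb} → Sorted (c₁ ∷ c₂ ∷ D) → labelIn lb c₁ ≡ 3 → labelIn lb c₂ ≡ 3 →
             just (st a2 (c₁ ∷ c₂ ∷ D) lb 0) ~ free D
    once~  : ∀ {a2 D lb m} → Sorted (c₂ ∷ D) → labelIn lb c₁ ≡ m → labelIn lb c₂ ≡ 3 →
             just (st a2 (c₂ ∷ D) lb 1) ~ once m D
    fail~  : nothing ~ dead
    label~ : ∀ {a2 a3 lb w} → labelIn lb c₂ ≢ 3 → just (st a2 a3 lb w) ~ dead
    still~ : ∀ {a2 D lb} → Sorted (c₂ ∷ D) → just (st a2 (c₂ ∷ D) lb 0) ~ dead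

  label-new : ∀ z {ℓ} lb → labelIn ((z , ℓ) ∷ lb) z ≡ ℓ
  label-new z lb rewrite ≡ᵇ-refl z = refl

  label-old′ : ∀ {z ℓ} lb {c} → z ≢ c → labelIn ((z , ℓ) ∷ lb) c ≡ labelIn lb c
  label-old′ lb z≢c rewrite ≡ᵇ-false z≢c = refl

  label-old : ∀ {z ℓ} lb {c} → c < z → labelIn ((z , ℓ) ∷ lb) c ≡ labelIn lb c
  label-old lb lt = label-old′ lb (>⇒≢ lt)

  module _ {ℓ : ℕ} (ℓ≢3 : ℓ ≢ 3) where

    label-c₂ : ∀ z lb → labelIn lb c₂ ≢ 3 → labelIn ((z , ℓ) ∷ lb) c₂ ≢ 3
    label-c₂ z lb h with z ≡ᵇ c₂
    ... | true  = ℓ≢3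
    ... | false = h

    new₂ : ∀ lb → labelIn ((c₂ , ℓ) ∷ lb) c₂ ≢ 3
    new₂ lb = subst (_≢ 3) (sym (label-new c₂ lb)) ℓ≢3

    to : ∀ {m κ κ′} → κ ≡ κ′ → m ~ κ′ → m ~ κ
    to refl r = r

    via : ∀ {y z b a3 a2 lb w κ} → pick y a3 ≡ just (z , b) →
      just (st a2 (remove z a3) ((z , ℓ) ∷ lb) (if b then suc w else w)) ~ κ →
      step23 ℓ y (st a2 a3 lb w) ~ κ
    via pk = subst (_~ _) (sym (step23-pick ℓ pk))

    via′ : ∀ {y z b a3 a3′ a3″ a2 lb w κ} → pick y a3 ≡ just (z , b) → remove z a3 ≡ a3′ → a3′ ≡ a3″ →
      just (st a2 a3″ ((z , ℓ) ∷ lb) (if b then suc w else w)) ~ κ →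
      step23 ℓ y (st a2 a3 lb w) ~ κ
    via′ pk refl refl = via pk

    -- An entry y ≥ c₂ finds larger entries only in `D`, and a wrapping hits c₁ as long as it is
    -- available, afterwards c₂, which is fatal. An entry y < c₂ takes c₁ or c₂ without wrapping, or
    -- finds the state already lost.
    step~ : ∀ {m κ} y → m ~ κ → (m >>= step23 ℓ y) ~ bullies ℓ κ y
    step~ y fail~ = fail~
    step~ y (label~ {a3 = a3} {lb = lb} h) with pick y a3
    ... | nothing      = fail~
    ... | just (z , b) = label~ (label-c₂ z lb h)
    step~ y (still~ {D = D} {lb} s) with y <? c₂
    ... | yes lt = via (pick-head D lt) (label~ (new₂ lb))
    ... | no  ge with pick-view y c₂ D
    ...   | wraps _ pk = via pk (label~ (new₂ lb))
    ...   | larger z _ pk _ δ = via′ pk (Delete-remove s δ) (removeGt-skip D (≮⇒≥ ge))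
                                  (still~ (subst Sorted (removeGt-skip D (≮⇒≥ ge)) (Delete-Sorted δ s)))
    step~ y (once~ {D = D} {lb} {m} s e₁ e₂) with y <? c₂
    ... | yes lt = to (bullies-low ℓ (once m D) lt) (via (pick-head D lt) (label~ (new₂ lb)))
    ... | no  ge with pick-view y c₂ D
    ...   | wraps h pk =
      to (trans (bullies-once ℓ m D (≮⇒≥ ge)) (cong (if_then once m (removeGt y D) else dead) h′)) (via pk (label~ (new₂ lb)))
      where
      h′ : hasGt y D ≡ false
      h′ = trans (sym (hasGt-skip D (≮⇒≥ ge))) h
    ...   | larger z h pk y<z δ =
      to (trans (bullies-once ℓ m D (≮⇒≥ ge)) (cong (if_then once m (removeGt y D) else dead) h′))
        (via′ pk (Delete-remove s δ) (removeGt-skip D (≮⇒≥ ge))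
          (once~ (subst Sorted (removeGt-skip D (≮⇒≥ ge)) (Delete-Sorted δ s))
            (trans (label-old lb (<-trans c₁<c₂ c₂<z)) e₁) (trans (label-old lb c₂<z) e₂)))
      where
      c₂<z : c₂ < z
      c₂<z = ≤-<-trans (≮⇒≥ ge) y<z
      h′ : hasGt y D ≡ true
      h′ = trans (sym (hasGt-skip D (≮⇒≥ ge))) h
    step~ y (free~ {D = D} {lb} s e₁ e₂) with y <? c₁
    ... | yes lt = to (bullies-low ℓ (free D) (<-trans lt c₁<c₂))
      (via′ (pick-head (c₂ ∷ D) lt) (Delete-remove s here) refl (still~ (AllPairs.tail s)))
    ... | no  ge₁ with y <? c₂
    ...   | yes lt = to (bullies-low ℓ (free D) lt) (via (pick-second D (≮⇒≥ ge₁) lt) (label~ (new₂ lb)))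
    ...   | no  ge with pick-view y c₁ (c₂ ∷ D)
    ...     | wraps h pk =
      to (trans (bullies-free ℓ D (≮⇒≥ ge)) (cong (if_then free (removeGt y D) else once ℓ D) h′))
        (via′ pk (Delete-remove s here) refl
          (once~ (AllPairs.tail s) (label-new c₁ lb) (trans (label-old′ lb (<⇒≢ c₁<c₂)) e₂)))
      where
      h′ : hasGt y D ≡ false
      h′ = trans (sym (trans (hasGt-skip (c₂ ∷ D) (≮⇒≥ ge₁)) (hasGt-skip D (≮⇒≥ ge)))) h
    ...     | larger z h pk y<z δ =
      to (trans (bullies-free ℓ D (≮⇒≥ ge)) (cong (if_then free (removeGt y D) else once ℓ D) h′))
        (via′ pk (Delete-remove s δ) eq
          (free~ (subst Sorted eq (Delete-Sorted δ s))
            (trans (label-old lb (<-trans c₁<c₂ c₂<z)) e₁) (trans (label-old lb c₂<z) e₂)))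
      where
      c₂<z : c₂ < z
      c₂<z = ≤-<-trans (≮⇒≥ ge) y<z
      h′ : hasGt y D ≡ true
      h′ = trans (sym (trans (hasGt-skip (c₂ ∷ D) (≮⇒≥ ge₁)) (hasGt-skip D (≮⇒≥ ge)))) h
      eq : removeGt y (c₁ ∷ c₂ ∷ D) ≡ c₁ ∷ c₂ ∷ removeGt y D
      eq = trans (removeGt-skip (c₂ ∷ D) (≮⇒≥ ge₁)) (cong (c₁ ∷_) (removeGt-skip D (≮⇒≥ ge)))

    run~ : ∀ {m κ} ys → m ~ κ → (m >>= runAll (step23 ℓ) ys) ~ foldl (bullies ℓ) κ ys
    run~ {nothing} []       r = r
    run~ {just σ}  []       r = r
    run~ {nothing} (y ∷ ys) r = run~ {nothing} ys (step~ y r)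
    run~ {just σ}  (y ∷ ys) r with step23 ℓ y σ | step~ y r
    ... | nothing | r′ = run~ ys r′
    ... | just σ′ | r′ = run~ ys r′

  verdict : Status → Bool
  verdict (once m D) = m ≡ᵇ 1
  verdict _          = false

  verdict~ : ∀ {m κ} R → m ~ κ → outcome (c₁ ∷ c₂ ∷ R) m ≡ verdict κ
  verdict~ R (free~ _ _ _) = refl
  verdict~ R (once~ {m = m} _ e₁ e₂) rewrite e₁ | e₂ with m ≡ᵇ 1
  ... | true  = refl
  ... | false = refl
  verdict~ R fail~ = refl
  verdict~ R (label~ {lb = lb} {w = w} h) rewrite ≡ᵇ-false h =
    trans (cong ((w ≡ᵇ 1) ∧_) (∧-zeroʳ (labelIn lb c₁ ≡ᵇ 1))) (∧-zeroʳ (w ≡ᵇ 1))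
  verdict~ R (still~ _) = refl

  status : ℕ → List ℕ × ℕ → Status
  status ℓ (D , zero)        = free D
  status ℓ (D , suc zero)    = once ℓ D
  status ℓ (D , suc (suc _)) = dead

  bullies-status : ∀ ℓ s {y} → c₂ ≤ y → bullies ℓ (status ℓ s) y ≡ status ℓ (stepO s y)
  bullies-status ℓ (D , zero)        {y} le rewrite <ᵇ-false le with hasGt y D
  ... | true  = refl
  ... | false = refl
  bullies-status ℓ (D , suc zero)    {y} le rewrite <ᵇ-false le with hasGt y D
  ... | true  = refl
  ... | false = refl
  bullies-status ℓ (D , suc (suc _)) {y} le with hasGt y D
  ... | true  = refl
  ... | false = refl

  foldl-status : ∀ ℓ s ys → All (c₂ ≤_) ys → foldl (bullies ℓ) (status ℓ s) ys ≡ status ℓ (foldl stepO s ys)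
  foldl-status ℓ s []       []       = refl
  foldl-status ℓ s (y ∷ ys) (p ∷ ps) rewrite bullies-status ℓ s p = foldl-status ℓ (stepO s y) ys ps

  foldl-once : ∀ ℓ ℓ′ m D ys → foldl (bullies ℓ) (once m D) ys ≡ foldl (bullies ℓ′) (once m D) ys
  foldl-dead : ∀ ℓ ys → foldl (bullies ℓ) dead ys ≡ dead
  foldl-dead ℓ []       = refl
  foldl-dead ℓ (y ∷ ys) = foldl-dead ℓ ys
  foldl-once ℓ ℓ′ m D []       = refl
  foldl-once ℓ ℓ′ m D (y ∷ ys) with y <ᵇ c₂ | hasGt y D
  ... | true  | _     = trans (foldl-dead ℓ ys) (sym (foldl-dead ℓ′ ys))
  ... | false | true  = foldl-once ℓ ℓ′ m (removeGt y D) ys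
  ... | false | false = trans (foldl-dead ℓ ys) (sym (foldl-dead ℓ′ ys))

  verdict-status₁ : ∀ s → verdict (status 1 s) ≡ (proj₂ s ≡ᵇ 1)
  verdict-status₁ (D , zero)        = refl
  verdict-status₁ (D , suc zero)    = refl
  verdict-status₁ (D , suc (suc _)) = refl

  verdict-status₂ : ∀ s → verdict (status 2 s) ≡ false
  verdict-status₂ (D , zero)        = refl
  verdict-status₂ (D , suc zero)    = refl
  verdict-status₂ (D , suc (suc _)) = refl

  -- The label 1 on c₁ requires the wrapping to occur among the paths from row 1; the paths from row
  -- 2 must then add none.
  verdict-overflow : ∀ D ys zs → All (c₂ ≤_) ys → All (c₂ ≤_) zs →
    verdict (foldl (bullies 2) (foldl (bullies 1) (free D) ys) zs) ≡
      (proj₂ (foldl stepO (D , 0) ys) ≡ᵇ 1) ∧ (proj₂ (foldl stepO (foldl stepO (D , 0) ys) zs) ≡ᵇ 1)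
  verdict-overflow D ys zs hys hzs rewrite foldl-status 1 (D , 0) ys hys = second (foldl stepO (D , 0) ys)
    where
    second : ∀ s → verdict (foldl (bullies 2) (status 1 s) zs) ≡
      (proj₂ s ≡ᵇ 1) ∧ (proj₂ (foldl stepO s zs) ≡ᵇ 1)
    second (D , zero) = trans (cong verdict (foldl-status 2 (D , 0) zs hzs)) (verdict-status₂ (foldl stepO (D , 0) zs))
    second (D , suc zero) = trans (cong verdict (foldl-once 2 1 1 D zs))
      (trans (cong verdict (foldl-status 1 (D , 1) zs hzs)) (verdict-status₁ (foldl stepO (D , 1) zs)))
    second (D , suc (suc o)) = cong verdict (foldl-dead 2 zs)

  foldl-low : ∀ ℓ κ {y ys} → y < c₂ → y ∈ ys → foldl (bullies ℓ) κ ys ≡ dead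
  foldl-low ℓ κ {y} {_ ∷ ys} lt (here refl) =
    trans (cong (λ κ → foldl (bullies ℓ) κ ys) (bullies-low ℓ κ lt)) (foldl-dead ℓ ys)
  foldl-low ℓ κ lt (there p) = foldl-low ℓ _ lt p

-- From the procedure to the condition on words

bullyRows : List ℕ → List ℕ → List ℕ → Maybe St
bullyRows R₁ R₂ R₃ = runAll path1 R₁ (st R₂ R₃ [] 0) >>= λ σ → runAll (step23 2) (av2 σ) σ

bullyCond-rows : ∀ w → bullyCond w ≡ outcome (row3 w) (bullyRows (row1 w) (row2 w) (row3 w))
bullyCond-rows w with runAll path1 (row1 w) (st (row2 w) (row3 w) [] 0)
... | nothing = refl
... | just σ with runAll (step23 2) (av2 σ) σ
...   | nothing = refl
...   | just τ  = refl

-- Choices in row 2 do not look at row 3, so all paths may first be run to row 2 and then continued.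
phase1-run : ∀ {X L ys zs} a3 lb w → Phase1 X L ys zs →
  runAll path1 X (st L a3 lb w) ≡ runAll (step23 1) ys (st zs a3 lb w)
phase1-run a3 lb w done = refl
phase1-run a3 lb w (next {y = y} pk _ ph) rewrite pk with pick y a3
... | nothing      = refl
... | just (z , b) = phase1-run (remove z a3) ((z , 1) ∷ lb) (if b then suc w else w) ph

run-av2 : ∀ ℓ ys a2 a3 lb w {σ} → runAll (step23 ℓ) ys (st a2 a3 lb w) ≡ just σ → av2 σ ≡ a2
run-av2 ℓ []       a2 a3 lb w refl = refl
run-av2 ℓ (y ∷ ys) a2 a3 lb w eq with pick y a3
... | just (z , b) = run-av2 ℓ ys a2 (remove z a3) ((z , ℓ) ∷ lb) (if b then suc w else w) eq

phase1-bullyRows : ∀ {X L ys zs} R₃ → Phase1 X L ys zs →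
  bullyRows X L R₃ ≡ (runAll (step23 1) ys (st zs R₃ [] 0) >>= runAll (step23 2) zs)
phase1-bullyRows {ys = ys} {zs} R₃ ph rewrite phase1-run R₃ [] 0 ph
  with runAll (step23 1) ys (st zs R₃ [] 0) in eq
... | nothing = refl
... | just σ rewrite run-av2 1 ys zs R₃ [] 0 eq = refl

outcome-verdict : ∀ {X L ys zs c₁ c₂ D} (s : Sorted (c₁ ∷ c₂ ∷ D)) (lt : c₁ < c₂) → Phase1 X L ys zs →
  let open Row3 c₁ c₂ lt in
  outcome (c₁ ∷ c₂ ∷ D) (bullyRows X L (c₁ ∷ c₂ ∷ D)) ≡
  verdict (foldl (bullies 2) (foldl (bullies 1) (free D) ys) zs)
outcome-verdict {ys = ys} {zs} {c₁} {c₂} {D} s lt ph = trans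
  (cong (outcome (c₁ ∷ c₂ ∷ D)) (phase1-bullyRows (c₁ ∷ c₂ ∷ D) ph))
  (verdict~ D (run~ {2} (λ ()) zs (run~ {1} (λ ()) ys (free~ s refl refl))))
  where open Row3 c₁ c₂ lt

positionsFrom-Sorted : ∀ {X : Set} (p : X → Bool) i w → Sorted (positionsFrom p i w)
positionsFrom-Sorted p i []      = []
positionsFrom-Sorted p i (x ∷ w) with p x
... | true  = positionsFrom-all> p (suc i) w ≤-refl ∷ positionsFrom-Sorted p (suc i) w
... | false = positionsFrom-Sorted p (suc i) w

++-Sorted : ∀ {i X Y} → Sorted X → All (_< i) X → Sorted Y → (∀ {j} → j < i → All (j <_) Y) → Sorted (X ++ Y)
++-Sorted sX hX sY hY = AllPairsₚ.++⁺ sX sY (All.map hY hX)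

-- All 2s together must have overflow 1, and those bullied from row 1 must already have it. By
-- `procR-sub` the unbullied 2s `zs` then lie before the critical suffix, and by `phase1-drop` this
-- can be tested on the linearly unmatched 2s.
outcome-critPos : ∀ i w X c₁ c₂ → Sorted X → All (_< i) X → c₁ < c₂ → c₂ < i →
  length (X ++ pos1 i w) < length (pos2 i w) →
  outcome (c₁ ∷ c₂ ∷ pos3 i w) (bullyRows (X ++ pos1 i w) (pos2 i w) (c₁ ∷ c₂ ∷ pos3 i w)) ≡
  (overflow w ≡ᵇ 1) ∧ critMatched (length X) w
outcome-critPos i w X c₁ c₂ sX hX c₁<c₂ c₂<i lt
  with phase1-exists (X ++ pos1 i w) (pos2 i w) (positionsFrom-Sorted is2 i w) (<⇒≤ lt)
... | ys , zs , ph with phase1-interleaving ph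
...   | ys′ , sp , p = begin
  outcome (c₁ ∷ c₂ ∷ D) (bullyRows (X ++ pos1 i w) (pos2 i w) (c₁ ∷ c₂ ∷ D))
    ≡⟨ outcome-verdict sC c₁<c₂ ph ⟩
  R.verdict (foldl (R.bullies 2) (foldl (R.bullies 1) (free D) ys) zs)
    ≡⟨ R.verdict-overflow D ys zs (All-resp-↭ (↭-sym p) (proj₁ large)) (proj₂ large) ⟩
  (proj₂ (foldl stepO (D , 0) ys) ≡ᵇ 1) ∧ (proj₂ (foldl stepO (foldl stepO (D , 0) ys) zs) ≡ᵇ 1)
    ≡⟨ cong₂ (λ x y → (proj₂ x ≡ᵇ 1) ∧ (y ≡ᵇ 1)) (foldl≡procR sD p) total-overflow ⟩
  (proj₂ (procR D ys′) ≡ᵇ 1) ∧ (overflow w ≡ᵇ 1)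
    ≡⟨ conclude ⟩
  (overflow w ≡ᵇ 1) ∧ critMatched (length X) w ∎
  where
  open ≡-Reasoning
  module R = Row3 c₁ c₂ c₁<c₂
  D : List ℕ
  D = pos3 i w
  sD : Sorted D
  sD = positionsFrom-Sorted is3 i w
  sC : Sorted (c₁ ∷ c₂ ∷ D)
  sC = (c₁<c₂ ∷ positionsFrom-all> is3 i w (<-trans c₁<c₂ c₂<i)) ∷ positionsFrom-all> is3 i w c₂<i ∷ sD
  large : All (c₂ ≤_) ys′ × All (c₂ ≤_) zs
  large = Interleaving-All sp (All.map <⇒≤ (positionsFrom-all> is2 i w c₂<i))
  total-overflow : proj₂ (foldl stepO (foldl stepO (D , 0) ys) zs) ≡ overflow w
  total-overflow = trans (cong proj₂ (trans (sym (foldl-++ stepO (D , 0) ys zs))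
    (foldl≡procR sD (↭-trans (++⁺ʳ zs p) (↭-sym (toPermutation sp)))))) (proj₂ (procR-full i w))
  -- As row 1 is strictly shorter than row 2, some 2 stays unbullied; `before-drop` relies on this.
  zs-nonempty : 0 < length zs
  zs-nonempty = +-cancelˡ-< (length (X ++ pos1 i w)) 0 (length zs)
    (subst (_< length (X ++ pos1 i w) + length zs) (sym (+-identityʳ _)) (subst (length (X ++ pos1 i w) <_) (phase1-length ph) lt))
  U : List ℕ
  U = proj₁ (foldl stepO (pos2 i w , 0) (X ++ pos1 i w))
  before-zs : ∀ q → before q zs ≡ before q (unmatched (length X) i w)
  before-zs q with phase1-drop 0 (++-Sorted sX hX (positionsFrom-Sorted is1 i w) (positionsFrom-all> is1 i w))
                     (positionsFrom-Sorted is2 i w) ph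
  ... | n , eq = trans (cong (before q) eq)
    (trans (before-drop q n U (foldl-Sorted (pos2 i w , 0) (X ++ pos1 i w) (positionsFrom-Sorted is2 i w))
                            (subst (λ z → 0 < length z) eq zs-nonempty))
      (cong (before q) (foldl-unmatched i w X hX)))
  ⟦⟧≡ᵇ1 : ∀ b → (⟦ b ⟧ ≡ᵇ 1) ≡ b
  ⟦⟧≡ᵇ1 true  = refl
  ⟦⟧≡ᵇ1 false = refl
  conclude : (proj₂ (procR D ys′) ≡ᵇ 1) ∧ (overflow w ≡ᵇ 1) ≡ (overflow w ≡ᵇ 1) ∧ critMatched (length X) w
  conclude with overflow w in eq
  ... | zero        = ∧-zeroʳ _
  ... | suc (suc _) = ∧-zeroʳ _
  ... | suc zero    = trans (∧-identityʳ _) (trans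
    (cong (_≡ᵇ 1) (proj₁ (proj₂ (procR-sub i w sp) eq)))
    (trans (⟦⟧≡ᵇ1 _) (trans (before-zs (critPos i w)) (before-critPos (length X) i w eq))))

outcome-short : ∀ c m → outcome (c ∷ []) m ≡ false
outcome-short c nothing  = refl
outcome-short c (just σ) = ∧-zeroʳ (w23 σ ≡ᵇ 1)

outcome-empty : ∀ m → outcome [] m ≡ false
outcome-empty nothing  = refl
outcome-empty (just σ) = ∧-zeroʳ (w23 σ ≡ᵇ 1)

-- A 2 to the left of c₂ ends on c₂, or takes c₁ so that the first wrapping ends on c₂.
outcome-low : ∀ R₁ i R₂ c R → Sorted (i ∷ R₂) → Sorted (c ∷ R) → All (i <_) R →
  length R₁ ≤ length (i ∷ R₂) → outcome (c ∷ R) (bullyRows R₁ (i ∷ R₂) (c ∷ R)) ≡ false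
outcome-low R₁ i R₂ c []       s₂ s₃ h le = outcome-short c (bullyRows R₁ (i ∷ R₂) (c ∷ []))
outcome-low R₁ i R₂ c (d ∷ R) s₂ s₃@((c<d ∷ _) ∷ _) (i<d ∷ _) le
  with phase1-exists R₁ (i ∷ R₂) s₂ le
... | ys , zs , ph with phase1-interleaving ph
...   | ys′ , sp , p = trans (outcome-verdict s₃ c<d ph)
  (low (∈-++⁻ ys (∈-resp-↭ (↭-trans (toPermutation sp) (++⁺ʳ zs (↭-sym p))) (here refl))))
  where
  open Row3 c d c<d
  low : i ∈ ys ⊎ i ∈ zs → verdict (foldl (bullies 2) (foldl (bullies 1) (free R) ys) zs) ≡ false
  low (inj₁ q) = cong verdict (trans (cong (λ κ → foldl (bullies 2) κ zs) (foldl-low 1 (free R) i<d q)) (foldl-dead 2 zs))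
  low (inj₂ q) = cong verdict (foldl-low 2 (foldl (bullies 1) (free R) ys) i<d q)

snoc-below : ∀ {i X} → All (_< i) X → All (_< suc i) (X ++ i ∷ [])
snoc-below h = ++⁺ (All.map m<n⇒m<1+n h) (≤-refl ∷ [])

snoc-Sorted : ∀ {i X} → Sorted X → All (_< i) X → Sorted (X ++ i ∷ [])
snoc-Sorted s h = AllPairsₚ.++⁺ s ([] ∷ []) (All.map (_∷ []) h)

length-snoc : ∀ (X : List ℕ) i → length (X ++ i ∷ []) ≡ suc (length X)
length-snoc X i = trans (length-++ X) (+-comm (length X) 1)

-- `X` collects the 1s read so far and c is the first entry of row 3; a 2 met before the second
-- entry is excluded by `outcome-low`.
outcome-accepts₁ : ∀ i w X c → Sorted X → All (_< i) X → c < i → length (X ++ pos1 i w) < length (pos2 i w) →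
  lastIs3 w ∧ outcome (c ∷ pos3 i w) (bullyRows (X ++ pos1 i w) (pos2 i w) (c ∷ pos3 i w)) ≡ accepts₁ (length X) w
outcome-accepts₁ i []       X c sX hX c<i lt = refl
outcome-accepts₁ i (r1 ∷ w) X c sX hX c<i lt rewrite sym (++-assoc X (i ∷ []) (pos1 (suc i) w)) | lastIs3-r1 w =
  trans (outcome-accepts₁ (suc i) w (X ++ i ∷ []) c (snoc-Sorted sX hX) (snoc-below hX) (m<n⇒m<1+n c<i) lt)
    (cong (λ k → accepts₁ k w) (length-snoc X i))
outcome-accepts₁ i (r2 ∷ w) X c sX hX c<i lt = trans (cong (lastIs3 (r2 ∷ w) ∧_)
  (outcome-low (X ++ pos1 (suc i) w) i (pos2 (suc i) w) c (pos3 (suc i) w) (positionsFrom-Sorted is2 i (r2 ∷ w))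
    (positionsFrom-all> is3 (suc i) w (m<n⇒m<1+n c<i) ∷ positionsFrom-Sorted is3 (suc i) w)
    (positionsFrom-all> is3 (suc i) w ≤-refl) (<⇒≤ lt)))
  (∧-zeroʳ (lastIs3 (r2 ∷ w)))
outcome-accepts₁ i (r3 ∷ w) X c sX hX c<i lt
  rewrite outcome-critPos (suc i) w X c i sX (All.map m<n⇒m<1+n hX) c<i ≤-refl lt = last3 w
  where
  last3 : ∀ w → lastIs3 (r3 ∷ w) ∧ (overflow w ≡ᵇ 1) ∧ critMatched (length X) w ≡ suffixAccepts (length X) w
  last3 []      = refl
  last3 (_ ∷ _) = refl

outcome-accepts₀ : ∀ i w X → Sorted X → All (_< i) X → length (X ++ pos1 i w) < length (pos2 i w) →
  lastIs3 w ∧ outcome (pos3 i w) (bullyRows (X ++ pos1 i w) (pos2 i w) (pos3 i w)) ≡ accepts₀ (length X) w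
outcome-accepts₀ i []       X sX hX lt = refl
outcome-accepts₀ i (r1 ∷ w) X sX hX lt rewrite sym (++-assoc X (i ∷ []) (pos1 (suc i) w)) | lastIs3-r1 w =
  trans (outcome-accepts₀ (suc i) w (X ++ i ∷ []) (snoc-Sorted sX hX) (snoc-below hX) lt)
    (cong (λ k → accepts₀ k w) (length-snoc X i))
outcome-accepts₀ i (r2 ∷ w) X sX hX lt = trans (cong (lastIs3 (r2 ∷ w) ∧_)
  (none (pos3 (suc i) w) (positionsFrom-Sorted is3 (suc i) w) (positionsFrom-all> is3 (suc i) w ≤-refl)))
  (∧-zeroʳ (lastIs3 (r2 ∷ w)))
  where
  none : ∀ R → Sorted R → All (i <_) R →
    outcome R (bullyRows (X ++ pos1 (suc i) w) (i ∷ pos2 (suc i) w) R) ≡ false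
  none []      s h       = outcome-empty (bullyRows (X ++ pos1 (suc i) w) (i ∷ pos2 (suc i) w) [])
  none (c ∷ R) s (_ ∷ h) = outcome-low (X ++ pos1 (suc i) w) i (pos2 (suc i) w) c R
    (positionsFrom-Sorted is2 i (r2 ∷ w)) s h (<⇒≤ lt)
outcome-accepts₀ i (r3 ∷ w) X sX hX lt = trans (last3 w)
  (outcome-accepts₁ (suc i) w X i sX (All.map m<n⇒m<1+n hX) ≤-refl lt)
  where
  last3 : ∀ w → lastIs3 (r3 ∷ w) ∧ outcome (i ∷ pos3 (suc i) w) (bullyRows (X ++ pos1 (suc i) w) (pos2 (suc i) w) (i ∷ pos3 (suc i) w))
    ≡ lastIs3 w ∧ outcome (i ∷ pos3 (suc i) w) (bullyRows (X ++ pos1 (suc i) w) (pos2 (suc i) w) (i ∷ pos3 (suc i) w))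
  -- The final 3 is the only entry of row 3, so the projected word is too short.
  last3 []      = outcome-short i (bullyRows (X ++ []) [] (i ∷ []))
  last3 (_ ∷ _) = refl

-- The count of queues

content-lengths : ∀ i w a b c → content w a b c ≡ true → length (pos1 i w) ≡ a × length (pos2 i w) ≡ b
content-lengths i []       zero    zero    zero    h = refl , refl
content-lengths i (r1 ∷ w) (suc a) b       c       h = let p , q = content-lengths (suc i) w a b c h in cong suc p , q
content-lengths i (r2 ∷ w) a       (suc b) c       h = let p , q = content-lengths (suc i) w a b c h in p , cong suc q
content-lengths i (r3 ∷ w) a       b       (suc c) h = content-lengths (suc i) w a b c h

good-accepts₀ : ∀ s t n w → 1 ≤ t → good s t n w ≡ content w s (s + t) n ∧ accepts₀ 0 w
good-accepts₀ s t n w 1≤t rewrite content-length 1 w s (s + t) n with content w s (s + t) n in eq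
... | false = refl
... | true  = trans (cong (lastIs3 w ∧_) (bullyCond-rows w)) (outcome-accepts₀ 1 w [] [] [] shorter)
  where
  shorter : length (row1 w) < length (row2 w)
  shorter rewrite proj₁ (content-lengths 1 w s (s + t) n eq) | proj₂ (content-lengths 1 w s (s + t) n eq) =
    m<m+n s 1≤t

binomMinus2-bm : ∀ s t e → binomMinus2 ((suc (s + t + e) + 2 * s + t) ∸ 1) s ≡ binom₋₂ s (2 + ((s + t) + (s + t) + e))
binomMinus2-bm zero          t e = refl
binomMinus2-bm (suc zero)    t e = refl
binomMinus2-bm (suc (suc a)) t e = cong (_C a) (lem a t e)
  where
  lem : ∀ a t e → suc (suc (a + t + e)) + 2 * suc (suc a) + t ≡ a + (2 + ((suc (suc a) + t) + (suc (suc a) + t) + e))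
  lem = solve-∀

theorem5p4 : (s t n : ℕ) → 1 ≤ s → 1 ≤ t → s + t < n →
    β13 s t n ≡ binomMinus2 ((n + 2 * s + t) ∸ 1) s * f (n ∸ 1) (s + t)
theorem5p4 s@(suc s′) t n 1≤s 1≤t s+t<n = subst
  (λ n → β13 s t n ≡ binomMinus2 ((n + 2 * s + t) ∸ 1) s * f (n ∸ 1) (s + t))
  -- Writing n = s + t + 1 + e turns the shape (n - 1, s + t) into the form (b + e, b) of `f-syt`.
  (m+[n∸m]≡n s+t<n) (main (n ∸ suc (s + t)))
  where
  open ≡-Reasoning
  size : ∀ s t e → suc (s + t + e) + 2 * s + t ≡ s + (s + t) + suc (s + t + e)
  size = solve-∀
  main : ∀ e → β13 s t (suc (s + t + e)) ≡
    binomMinus2 ((suc (s + t + e) + 2 * s + t) ∸ 1) s * f (s + t + e) (s + t)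
  main e = begin
    β13 s t n′
      ≡⟨ count-allWords rows (good s t n′) N ⟩
    wsum rows (λ w → ⟦ good s t n′ w ⟧) N
      ≡⟨ wsum-cong rows (λ w → cong ⟦_⟧ (good-accepts₀ s t n′ w 1≤t)) N ⟩
    count (accepts₀ 0) N s (s + t) n′
      -- Apart from the first two entries of row 3 there remain s′ + t + e of them; as s = s′ + 1,
      -- the relation between c, b and e holds by `refl`.
      ≡⟨ count-accepts₀ N s (s + t) e (s′ + t + e) refl (m<m+n s 1≤t) (size s t e) ⟩
    binom₋₂ s (2 + ((s + t) + (s + t) + e)) * syt (s + t) e
      ≡⟨ cong₂ _*_ (binomMinus2-bm s t e) (f-syt (s + t) e) ⟨
    binomMinus2 (N ∸ 1) s * f (s + t + e) (s + t) ∎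
    where
    n′ N : ℕ
    n′ = suc (s + t + e)
    N  = n′ + 2 * s + t
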